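{- Suppose the maximum degree $\Delta$ of any vertex of $G$ is at most $m^{1/2-\alpha}$, where $\alpha>0$, and $t\le C\le\min(m^{2\alpha},m^{1/3})$. Then the expected number (over the random coloring) of $2k$-tuples $\vec T=(\vec T_1,\vec T_2)$ of edges of $\vec G$ such that $\vec T_1$ and $\vec T_2$ are both distinctly color-compatible, $\vec T$ satisfies Condition 1 or 3 at every vertex of $H$, and $\vec T$ does not satisfy Condition 1 at every vertex of $H$, is $O(m^k/C^{2k-t})$, with implied constant depending only on $H$.
   Context: $H$ is a fixed connected finite simple graph with no leaves, vertices $1,\dots,t$, $k$ edges, oriented arbitrarily as $\vec H$ with directed edges $\overrightarrow{a_1a_2},\dots,\overrightarrow{a_{2k-1}a_{2k}}$, $a_i\in\{1,\dots,t\}$; $\Gamma(b)=\{i\in\{1,\dots,2k\}:a_i=b\}$. $G$ is a finite simple graph; $\vec G$ replaces each edge $vw$ by $\overrightarrow{vw},\overrightarrow{wv}$; $m$ is the number of edges of $\vec G$. A coloring $\mathcal C:V(G)\to\{1,\dots,C\}$ is chosen uniformly from a $4k$-wise independent family of hash functions, each value uniform. A $k$-tuple $(\overrightarrow{u_1u_2},\dots,\overrightarrow{u_{2k-1}u_{2k}})$ of edges of $\vec G$ is distinctly color-compatible if there are pairwise distinct colors $c_1,\dots,c_t$ with $\mathcal C(u_i)=c_{a_i}$ for all $i$. Write $\vec T_1=(\overrightarrow{v_1v_2},\dots,\overrightarrow{v_{2k-1}v_{2k}})$, $\vec T_2=(\overrightarrow{w_1w_2},\dots,\overrightarrow{w_{2k-1}w_{2k}})$.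 Conditions at a vertex $b$ of $H$: Condition 1: the $v_i$, $i\in\Gamma(b)$, are all equal and the $w_i$, $i\in\Gamma(b)$, are all equal. Condition 3: there are vertices $x,y$ of $G$ such that for every $i\in\Gamma(b)$, either ($v_i=x$, $w_i=y$) or ($v_i=y$, $w_i=x$). -}

module Defs where

open import Data.Nat using (ℕ; zero; suc; _+_; _*_; _∸_; _^_; _≤_; _⊔_)
open import Data.Fin using (Fin; _≟_)
open import Data.Fin.Properties using (all?)
open import Data.Bool using (Bool; true; false)
import Data.Bool as B
open import Data.Product using (Σ; ∃; ∃-syntax; _×_; _,_; proj₁; proj₂)
open import Data.Sum using (_⊎_)
open import Data.List using (List; []; _∷_; map; concatMap; filter; length; allFin; cartesianProduct; foldr)
open import Data.Nat.ListAction using (sum)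
open import Agda.Primitive using (lzero)
import Data.Vec.Functional as VF
open import Relation.Nullary using (¬_)
open import Relation.Unary using (Pred; Decidable)
open import Relation.Binary.PropositionalEquality using (_≡_; _≢_)
open import Relation.Binary.Construct.Closure.ReflexiveTransitive using (Star)
open import Function.Definitions using (Injective)

allFuns : {X : Set} → List X → (r : ℕ) → List (Fin r → X)
allFuns xs zero    = (λ ()) ∷ []
allFuns xs (suc r) = concatMap (λ x → map (λ g → x VF.∷ g) (allFuns xs r)) xs

countFin : (N : ℕ) {P : Pred (Fin N) lzero} → Decidable P → ℕ
countFin N P? = length (filter P? (allFin N))

-- The pattern graph H, given by its oriented edges
-- arc j = (a_{2j-1} , a_{2j}) : the j-th directed edge of H⃗.
-- A position i ∈ {1,…,2k} is encoded as (j , s) : Fin k × Bool,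
-- s = false for the tail a_{2j-1}, s = true for the head a_{2j}.

Pos : ℕ → Set
Pos k = Fin k × Bool

positions : (k : ℕ) → List (Pos k)
positions k = cartesianProduct (allFin k) (false ∷ true ∷ [])

endOf : {A : Set} → A × A → Bool → A
endOf e false = proj₁ e
endOf e true  = proj₂ e

aH : ∀ {t k} → (Fin k → Fin t × Fin t) → Pos k → Fin t
aH arc (j , s) = endOf (arc j) s

AdjH : ∀ {t k} → (Fin k → Fin t × Fin t) → Fin t → Fin t → Set
AdjH arc x y = ∃[ j ] ((proj₁ (arc j) ≡ x × proj₂ (arc j) ≡ y) ⊎ (proj₁ (arc j) ≡ y × proj₂ (arc j) ≡ x))

SimpleH : ∀ {t k} → (Fin k → Fin t × Fin t) → Set
SimpleH {t} {k} arc =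
  (∀ j → proj₁ (arc j) ≢ proj₂ (arc j)) ×
  (∀ j j' → AdjH-one j j' → j ≡ j')
  where
  AdjH-one : Fin k → Fin k → Set
  AdjH-one j j' = (proj₁ (arc j) ≡ proj₁ (arc j') × proj₂ (arc j) ≡ proj₂ (arc j'))
                ⊎ (proj₁ (arc j) ≡ proj₂ (arc j') × proj₂ (arc j) ≡ proj₁ (arc j'))

ConnectedH : ∀ {t k} → (Fin k → Fin t × Fin t) → Set
ConnectedH arc = ∀ x y → Star (AdjH arc) x y

degH : ∀ {t k} → (Fin k → Fin t × Fin t) → Fin t → ℕ
degH {k = k} arc b = length (filter (λ p → aH arc p ≟ b) (positions k))

NoLeavesH : ∀ {t k} → (Fin k → Fin t × Fin t) → Set
NoLeavesH arc = ∀ b → degH arc b ≢ 1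

SimpleGraph : (n : ℕ) → (Fin n → Fin n → Bool) → Set
SimpleGraph n E = (∀ v w → E v w ≡ E w v) × (∀ v → E v v ≡ false)

numArcs : (n : ℕ) → (Fin n → Fin n → Bool) → ℕ
numArcs n E = length (filter (λ vw → E (proj₁ vw) (proj₂ vw) B.≟ true) (cartesianProduct (allFin n) (allFin n)))

degG : (n : ℕ) → (Fin n → Fin n → Bool) → Fin n → ℕ
degG n E v = length (filter (λ w → E v w B.≟ true) (allFin n))

maxDegree : (n : ℕ) → (Fin n → Fin n → Bool) → ℕ
maxDegree n E = foldr _⊔_ 0 (map (degG n E) (allFin n))

-- Hash family: N functions Fin n → Fin C, chosen uniformly;
-- 4k-wise independent with uniform values: for any r ≤ 4k distinct
-- vertices and any prescribed colours, exactly N / C^r members agree.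

Independent : (n C N r₀ : ℕ) → (Fin N → Fin n → Fin C) → Set
Independent n C N r₀ fam =
  ∀ r → r ≤ r₀ → (xs : Fin r → Fin n) → Injective _≡_ _≡_ xs → (cs : Fin r → Fin C) →
  countFin N (λ i → all? (λ l → fam i (xs l) ≟ cs l)) * C ^ r ≡ N

ETuple : ℕ → ℕ → Set
ETuple n k = Fin k → Fin n × Fin n

uAt : ∀ {n k} → ETuple n k → Pos k → Fin n
uAt T (j , s) = endOf (T j) s

AllArcs : ∀ {n k} → (Fin n → Fin n → Bool) → ETuple n k → Set
AllArcs E T = ∀ j → E (proj₁ (T j)) (proj₂ (T j)) ≡ true

DistinctlyColorCompatible : ∀ {t k n C} → (Fin k → Fin t × Fin t) →
  (Fin n → Fin C) → ETuple n k → Set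
DistinctlyColorCompatible {t} {C = C} arc col T =
  Σ (Fin t → Fin C) λ c → Injective _≡_ _≡_ c × (∀ p → col (uAt T p) ≡ c (aH arc p))

Condition1 : ∀ {t k n} → (Fin k → Fin t × Fin t) → ETuple n k → ETuple n k → Fin t → Set
Condition1 arc T₁ T₂ b = ∀ p q → aH arc p ≡ b → aH arc q ≡ b →
  uAt T₁ p ≡ uAt T₁ q × uAt T₂ p ≡ uAt T₂ q

Condition3 : ∀ {t k n} → (Fin k → Fin t × Fin t) → ETuple n k → ETuple n k → Fin t → Set
Condition3 {n = n} arc T₁ T₂ b = Σ (Fin n) λ x → Σ (Fin n) λ y → ∀ p → aH arc p ≡ b →
  (uAt T₁ p ≡ x × uAt T₂ p ≡ y) ⊎ (uAt T₁ p ≡ y × uAt T₂ p ≡ x)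

Counted : ∀ {t k n C} → (Fin k → Fin t × Fin t) → (Fin n → Fin n → Bool) →
  (Fin n → Fin C) → Pred (ETuple n k × ETuple n k) lzero
Counted {t} arc E col (T₁ , T₂) =
  AllArcs E T₁ × AllArcs E T₂ ×
  DistinctlyColorCompatible arc col T₁ × DistinctlyColorCompatible arc col T₂ ×
  (∀ (b : Fin t) → Condition1 arc T₁ T₂ b ⊎ Condition3 arc T₁ T₂ b) ×
  ¬ (∀ (b : Fin t) → Condition1 arc T₁ T₂ b)

-- all 2k-tuples of ordered vertex pairs (edge-ness is part of Counted)
allTuples : (n k : ℕ) → List (ETuple n k × ETuple n k)
allTuples n k = cartesianProduct (allFuns pairs k) (allFuns pairs k)
  where pairs = cartesianProduct (allFin n) (allFin n)

-- Σ over the family of the number of counted tuples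
-- (the expectation is this divided by N)
totalCount : ∀ {t k n C} → (arc : Fin k → Fin t × Fin t) → (E : Fin n → Fin n → Bool) →
  (N : ℕ) → (fam : Fin N → Fin n → Fin C) →
  (∀ i → Decidable (Counted arc E (fam i))) → ℕ
totalCount {k = k} {n = n} arc E N fam dec =
  sum (map (λ i → length (filter (dec i) (allTuples n k))) (allFin N))

{-# OPTIONS --safe #-}
-- Fix for each vertex b of H one position at b, and let X_b, Y_b be the vertices that T₁, T₂
-- put there.  Conditions 1 and 3 say that at any position p at b the pair (v_p , w_p) is
-- (X_b , Y_b) or (Y_b , X_b); this choice is the sign of p, and T is a lift, i.e. a homomorphism
-- to G of the double cover of H given by the signs.  Since K may depend on H it suffices
-- to bound the contribution of each of the finitely many sign patterns.  Let D = max(Δ , 1), so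
-- D²C ≤ m.
--
-- A vertex b with a position p of negative sign has X_b ≠ v_p of equal colour: this has
-- probability 1/C, and 1/C² if there are two such vertices.  As H is connected, there are at most
-- m² D^(2(t-2)) lifts.  With D²C ≤ m and C³ ≤ m this is enough if there are two
-- such vertices or if t < k.  Otherwise H is 2-regular, and by parity the double cover is
-- connected, so there are at most m D^(2t-2) lifts.

module Submission where

open import Defs
open import Data.Nat using (ℕ; zero; suc; _+_; _*_; _∸_; _^_; _⊔_; _≤_; _<_; z≤n; s≤s; s≤s⁻¹; NonZero; >-nonZero)
open import Data.Nat.Properties
open import Data.Nat.ListAction using (sum)
open import Data.Nat.ListAction.Properties using (sum-++)
open import Data.Fin using (Fin; zero; suc)
import Data.Fin as F
open import Data.Nat.Divisibility using (_∣_; divides; _∣0; ∣-refl; ∣m∣n⇒∣m+n; ∣m+n∣m⇒∣n; m∣m*n)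
import Data.Fin.Properties as F
open import Data.Bool using (Bool; true; false; not)
import Data.Bool as B
open import Data.Nat.Solver using (module +-*-Solver)
open import Data.Product using (∃-syntax; _×_; _,_; proj₁; proj₂)
open import Data.Product.Properties using (≡-dec)
open import Data.Sum using (_⊎_; inj₁; inj₂)
open import Data.List using (List; []; _∷_; _++_; map; concatMap; filter; foldr; length; allFin; cartesianProduct)
open import Data.List.Properties using (map-++; map-∘; length-map; length-++; filter-notAll; length-tabulate)
open import Data.List.Membership.Propositional using (_∈_)
open import Data.List.Membership.Propositional.Properties
open import Data.List.Relation.Unary.Any using (here; there)
import Data.List.Relation.Unary.Any as Any
import Data.List.Relation.Unary.All as All
open import Data.List.Relation.Unary.AllPairs using ([]; _∷_)
open import Data.List.Relation.Unary.Unique.Propositional using (Unique)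
open import Data.List.Relation.Unary.Unique.Propositional.Properties using (allFin⁺; cartesianProduct⁺)
import Data.Vec.Functional as VF
open import Algebra.Properties.CommutativeSemigroup *-commutativeSemigroup using (x∙yz≈y∙xz; interchange)
open import Algebra.Properties.CommutativeSemigroup +-commutativeSemigroup using () renaming (x∙yz≈y∙xz to +-exchange)
open import Function.Definitions using (Injective)
open import Relation.Nullary using (¬_; Dec; yes; no; contradiction)
open import Relation.Nullary.Decidable using (does; ¬?; _×-dec_; _⊎-dec_)
open import Relation.Unary using (Pred; Decidable)
open import Relation.Binary using (DecidableEquality)
open import Relation.Binary.Construct.Closure.ReflexiveTransitive using (Star; ε; _◅_)
open import Relation.Binary.PropositionalEquality

-- Finite sums over lists, and indicators

∑ : {A : Set} → List A → (A → ℕ) → ℕ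
∑ xs f = sum (map f xs)

syntax ∑ xs (λ x → e) = ∑[ x ∈ xs ] e

⟦_⟧ : {P : Set} → Dec P → ℕ
⟦ yes _ ⟧ = 1
⟦ no  _ ⟧ = 0

⟦⟧-mono : {P Q : Set} (p : Dec P) (q : Dec Q) → (P → Q) → ⟦ p ⟧ ≤ ⟦ q ⟧
⟦⟧-mono (no _)  _       _ = z≤n
⟦⟧-mono (yes _) (yes _) _ = ≤-refl
⟦⟧-mono (yes p) (no ¬q) f = contradiction (f p) ¬q

⟦⟧-true : {P : Set} (d : Dec P) → P → ⟦ d ⟧ ≡ 1
⟦⟧-true (yes _) _ = refl
⟦⟧-true (no ¬p) p = contradiction p ¬p

⟦⟧-false : {P : Set} (d : Dec P) → ¬ P → ⟦ d ⟧ ≡ 0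
⟦⟧-false (yes p) ¬p = contradiction p ¬p
⟦⟧-false (no _)  _  = refl

⟦⟧-pos : {P : Set} (d : Dec P) → 0 < ⟦ d ⟧ → P
⟦⟧-pos (yes p) _ = p

module _ {A : Set} where

  ∑-cong : ∀ xs {f g : A → ℕ} → (∀ x → f x ≡ g x) → ∑ xs f ≡ ∑ xs g
  ∑-cong []       f≗g = refl
  ∑-cong (x ∷ xs) f≗g = cong₂ _+_ (f≗g x) (∑-cong xs f≗g)

  ∑-mono : ∀ xs {f g : A → ℕ} → (∀ x → f x ≤ g x) → ∑ xs f ≤ ∑ xs g
  ∑-mono []       f≤g = z≤n
  ∑-mono (x ∷ xs) f≤g = +-mono-≤ (f≤g x) (∑-mono xs f≤g)

  ∑-mono-< : ∀ {xs y} {f g : A → ℕ} → (∀ x → f x ≤ g x) → y ∈ xs → f y < g y → ∑ xs f < ∑ xs g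
  ∑-mono-< {x ∷ xs} f≤g (here refl) fy<gy = +-mono-<-≤ fy<gy (∑-mono xs f≤g)
  ∑-mono-< {x ∷ xs} f≤g (there y∈)  fy<gy = +-mono-≤-< (f≤g x) (∑-mono-< f≤g y∈ fy<gy)

  ∑-const : ∀ (xs : List A) c → ∑[ x ∈ xs ] c ≡ length xs * c
  ∑-const []       c = refl
  ∑-const (x ∷ xs) c = cong (c +_) (∑-const xs c)

  ∑-bound : ∀ xs {f : A → ℕ} {c} → (∀ x → f x ≤ c) → ∑ xs f ≤ length xs * c
  ∑-bound xs {c = c} f≤c = ≤-trans (∑-mono xs f≤c) (≤-reflexive (∑-const xs c))

  ∑-+ : ∀ xs (f g : A → ℕ) → ∑[ x ∈ xs ] (f x + g x) ≡ ∑ xs f + ∑ xs g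
  ∑-+ []       f g = refl
  ∑-+ (x ∷ xs) f g = begin
    f x + g x + ∑[ y ∈ xs ] (f y + g y) ≡⟨ cong (f x + g x +_) (∑-+ xs f g) ⟩
    f x + g x + (∑ xs f + ∑ xs g)       ≡⟨ +-assoc (f x) (g x) _ ⟩
    f x + (g x + (∑ xs f + ∑ xs g))     ≡⟨ cong (f x +_) (+-exchange (g x) (∑ xs f) (∑ xs g)) ⟩
    f x + (∑ xs f + (g x + ∑ xs g))     ≡⟨ +-assoc (f x) _ _ ⟨
    f x + ∑ xs f + (g x + ∑ xs g)       ∎
    where
    open ≡-Reasoning

  ∑-*ʳ : ∀ xs (f : A → ℕ) c → ∑[ x ∈ xs ] (f x * c) ≡ ∑ xs f * c
  ∑-*ʳ []       f c = refl
  ∑-*ʳ (x ∷ xs) f c = trans (cong (f x * c +_) (∑-*ʳ xs f c)) (sym (*-distribʳ-+ c (f x) (∑ xs f)))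

  ∑-*ˡ : ∀ xs (f : A → ℕ) c → ∑[ x ∈ xs ] (c * f x) ≡ c * ∑ xs f
  ∑-*ˡ xs f c = trans (∑-cong xs λ x → *-comm c (f x)) (trans (∑-*ʳ xs f c) (*-comm (∑ xs f) c))

  ∑-++ : ∀ xs ys (f : A → ℕ) → ∑ (xs ++ ys) f ≡ ∑ xs f + ∑ ys f
  ∑-++ xs ys f = trans (cong sum (map-++ f xs ys)) (sum-++ (map f xs) (map f ys))

  ∈⇒≤∑ : ∀ {xs y} (f : A → ℕ) → y ∈ xs → f y ≤ ∑ xs f
  ∈⇒≤∑ f (here refl) = m≤m+n _ _
  ∈⇒≤∑ f (there y∈)  = ≤-trans (∈⇒≤∑ f y∈) (m≤n+m _ _)

  ∑-pos : ∀ xs (f : A → ℕ) → 0 < ∑ xs f → ∃[ x ] 0 < f x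
  ∑-pos (x ∷ xs) f 0<∑ with f x in eq
  ... | zero  = ∑-pos xs f 0<∑
  ... | suc _ = x , subst (0 <_) (sym eq) (s≤s z≤n)

  length-filter≡∑ : ∀ {P : Pred A _} (P? : Decidable P) xs → length (filter P? xs) ≡ ∑[ x ∈ xs ] ⟦ P? x ⟧
  length-filter≡∑ P? []       = refl
  length-filter≡∑ P? (x ∷ xs) with P? x
  ... | yes _ = cong suc (length-filter≡∑ P? xs)
  ... | no  _ = length-filter≡∑ P? xs

  1≤∑⟦⟧ : ∀ {P : Pred A _} (P? : Decidable P) {xs y} → y ∈ xs → P y → 1 ≤ ∑[ x ∈ xs ] ⟦ P? x ⟧
  1≤∑⟦⟧ P? {y = y} y∈ py = ≤-trans (≤-reflexive (sym (⟦⟧-true (P? y) py))) (∈⇒≤∑ (λ x → ⟦ P? x ⟧) y∈)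

  ∑⟦≟⟧≤1 : (_≟_ : DecidableEquality A) → ∀ {xs} → Unique xs → ∀ y → ∑[ x ∈ xs ] ⟦ x ≟ y ⟧ ≤ 1
  ∑⟦≟⟧≤1 _≟_ []              y = z≤n
  ∑⟦≟⟧≤1 _≟_ {x ∷ xs} (x∉ ∷ u) y with x ≟ y
  ... | no  _    = ∑⟦≟⟧≤1 _≟_ u y
  ... | yes refl = s≤s (≤-reflexive (absent x∉))
    where
    absent : ∀ {zs} → All.All (x ≢_) zs → ∑[ z ∈ zs ] ⟦ z ≟ x ⟧ ≡ 0
    absent All.[]         = refl
    absent (x≢z All.∷ ps) = cong₂ _+_ (⟦⟧-false (_ ≟ x) (λ z≡x → x≢z (sym z≡x))) (absent ps)

∑-map : ∀ {A B : Set} (g : A → B) xs (f : B → ℕ) → ∑ (map g xs) f ≡ ∑[ x ∈ xs ] f (g x)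
∑-map g xs f = cong sum (sym (map-∘ xs))

module _ {A B : Set} where

  ∑-concatMap : ∀ (g : A → List B) xs (f : B → ℕ) → ∑ (concatMap g xs) f ≡ ∑[ x ∈ xs ] ∑ (g x) f
  ∑-concatMap g []       f = refl
  ∑-concatMap g (x ∷ xs) f = trans (∑-++ (g x) (concatMap g xs) f) (cong (∑ (g x) f +_) (∑-concatMap g xs f))

  ∑-cartesianProduct : ∀ xs ys (f : A × B → ℕ) → ∑ (cartesianProduct xs ys) f ≡ ∑[ x ∈ xs ] ∑[ y ∈ ys ] f (x , y)
  ∑-cartesianProduct []       ys f = refl
  ∑-cartesianProduct (x ∷ xs) ys f = trans (∑-++ (map (x ,_) ys) (cartesianProduct xs ys) f)
    (cong₂ _+_ (∑-map (x ,_) ys f) (∑-cartesianProduct xs ys f))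

  ∑-swap : ∀ xs ys (f : A → B → ℕ) → ∑[ x ∈ xs ] ∑[ y ∈ ys ] f x y ≡ ∑[ y ∈ ys ] ∑[ x ∈ xs ] f x y
  ∑-swap []       ys f = sym (trans (∑-const ys 0) (*-zeroʳ (length ys)))
  ∑-swap (x ∷ xs) ys f = trans (cong (∑ ys (f x) +_) (∑-swap xs ys f))
    (sym (∑-+ ys (f x) (λ y → ∑[ z ∈ xs ] f z y)))

  length-cartesianProduct : ∀ (xs : List A) (ys : List B) → length (cartesianProduct xs ys) ≡ length xs * length ys
  length-cartesianProduct []       ys = refl
  length-cartesianProduct (x ∷ xs) ys = trans (length-++ (map (x ,_) ys))
    (cong₂ _+_ (length-map (x ,_) ys) (length-cartesianProduct xs ys))

  length-concatMap≤ : ∀ (g : A → List B) {c} → (∀ x → length (g x) ≤ c) → ∀ xs → length (concatMap g xs) ≤ length xs * c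
  length-concatMap≤ g g≤c []       = z≤n
  length-concatMap≤ g g≤c (x ∷ xs) = ≤-trans (≤-reflexive (length-++ (g x))) (+-mono-≤ (g≤c x) (length-concatMap≤ g g≤c xs))

-- Enumerating functions and counting tuples through a covering list

module _ {A : Set} (_≟_ : DecidableEquality A) where

  _≗?_ : ∀ {r} (f g : Fin r → A) → Dec (∀ j → f j ≡ g j)
  f ≗? g = F.all? (λ j → f j ≟ g j)

  -- Functions are compared pointwise. Agreement with `h` splits into agreement of the head and of
  -- the tail, so the sum factors and induction applies.
  allFuns-once : ∀ {xs} → Unique xs → ∀ r (h : Fin r → A) → ∑[ g ∈ allFuns xs r ] ⟦ g ≗? h ⟧ ≤ 1
  allFuns-once     u zero    h = ≤-reflexive (cong (_+ 0) (⟦⟧-true ((λ ()) ≗? h) λ ()))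
  allFuns-once {xs} u (suc r) h = begin
    ∑[ g ∈ allFuns xs (suc r) ] ⟦ g ≗? h ⟧
      ≡⟨ ∑-concatMap (λ x → map (λ g → x VF.∷ g) (allFuns xs r)) xs _ ⟩
    ∑[ x ∈ xs ] ∑[ g ∈ map (λ g → x VF.∷ g) (allFuns xs r) ] ⟦ g ≗? h ⟧
      ≡⟨ ∑-cong xs (λ x → ∑-map (λ g → x VF.∷ g) (allFuns xs r) _) ⟩
    ∑[ x ∈ xs ] ∑[ g ∈ allFuns xs r ] ⟦ (x VF.∷ g) ≗? h ⟧
      ≤⟨ ∑-mono xs (λ x → ∑-mono (allFuns xs r) (λ g → split x g)) ⟩
    ∑[ x ∈ xs ] ∑[ g ∈ allFuns xs r ] (⟦ x ≟ h zero ⟧ * ⟦ g ≗? (λ j → h (suc j)) ⟧)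
      ≡⟨ ∑-cong xs (λ x → ∑-*ˡ (allFuns xs r) _ ⟦ x ≟ h zero ⟧) ⟩
    ∑[ x ∈ xs ] (⟦ x ≟ h zero ⟧ * ∑[ g ∈ allFuns xs r ] ⟦ g ≗? (λ j → h (suc j)) ⟧)
      ≤⟨ ∑-mono xs (λ x → *-monoʳ-≤ ⟦ x ≟ h zero ⟧ (allFuns-once u r (λ j → h (suc j)))) ⟩
    ∑[ x ∈ xs ] (⟦ x ≟ h zero ⟧ * 1)
      ≡⟨ ∑-cong xs (λ x → *-identityʳ ⟦ x ≟ h zero ⟧) ⟩
    ∑[ x ∈ xs ] ⟦ x ≟ h zero ⟧
      ≤⟨ ∑⟦≟⟧≤1 _≟_ u (h zero) ⟩
    1 ∎
    where
    open ≤-Reasoning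
    split : ∀ x g → ⟦ (x VF.∷ g) ≗? h ⟧ ≤ ⟦ x ≟ h zero ⟧ * ⟦ g ≗? (λ j → h (suc j)) ⟧
    split x g with (x VF.∷ g) ≗? h
    ... | no _ = z≤n
    ... | yes e rewrite ⟦⟧-true (x ≟ h zero) (e zero) | ⟦⟧-true (g ≗? (λ j → h (suc j))) (λ j → e (suc j)) = ≤-refl

allFuns-complete : ∀ {A : Set} {xs : List A} → (∀ x → x ∈ xs) → ∀ r (h : Fin r → A) →
  ∃[ g ] g ∈ allFuns xs r × (∀ j → g j ≡ h j)
allFuns-complete full zero    h = _ , here refl , λ ()
allFuns-complete {xs = xs} full (suc r) h with allFuns-complete full r (λ j → h (suc j))
... | g , g∈ , g≗ = h zero VF.∷ g
  , ∈-concatMap⁺ (λ x → map (λ g → x VF.∷ g) (allFuns xs r)) (Any.map (λ { refl → ∈-map⁺ (λ f → h zero VF.∷ f) g∈ }) (full (h zero)))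
  , λ { zero → refl ; (suc j) → g≗ j }


-- Double counting of the pairs (`T` , `U`) that agree pointwise: each `T` with `P` has a partner in
-- `L`, and each `U` is the partner of at most one enumerated tuple. Repetitions in `L` do no harm.
count-covered : ∀ {n k} {P : Pred (ETuple n k × ETuple n k) _} (P? : Decidable P) (L : List (ETuple n k × ETuple n k)) →
  (∀ T → P T → ∃[ U ] U ∈ L × (∀ j → proj₁ T j ≡ proj₁ U j) × (∀ j → proj₂ T j ≡ proj₂ U j)) →
  ∑[ T ∈ allTuples n k ] ⟦ P? T ⟧ ≤ length L
count-covered {n} {k} P? L cover = begin
  ∑[ T ∈ allTuples n k ] ⟦ P? T ⟧
    ≤⟨ ∑-mono (allTuples n k) hit ⟩
  ∑[ T ∈ allTuples n k ] ∑[ U ∈ L ] same T U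
    ≡⟨ ∑-swap (allTuples n k) L same ⟩
  ∑[ U ∈ L ] ∑[ T ∈ allTuples n k ] same T U
    ≤⟨ ∑-bound L once ⟩
  length L * 1
    ≡⟨ *-identityʳ (length L) ⟩
  length L ∎
  where
  open ≤-Reasoning
  pairs = cartesianProduct (allFin n) (allFin n)
  _≟₂_ : DecidableEquality (Fin n × Fin n)
  _≟₂_ = ≡-dec F._≟_ F._≟_
  same : ETuple n k × ETuple n k → ETuple n k × ETuple n k → ℕ
  same (T₁ , T₂) (U₁ , U₂) = ⟦ _≗?_ _≟₂_ T₁ U₁ ⟧ * ⟦ _≗?_ _≟₂_ T₂ U₂ ⟧
  hit : ∀ T → ⟦ P? T ⟧ ≤ ∑[ U ∈ L ] same T U
  hit T with P? T
  ... | no _ = z≤n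
  ... | yes p with cover T p
  ...   | U , U∈L , e₁ , e₂ = ≤-trans
    (≤-reflexive (sym (cong₂ _*_ (⟦⟧-true (_≗?_ _≟₂_ _ _) e₁) (⟦⟧-true (_≗?_ _≟₂_ _ _) e₂))))
    (∈⇒≤∑ (same T) U∈L)
  unique : Unique pairs
  unique = cartesianProduct⁺ (allFin⁺ n) (allFin⁺ n)
  once : ∀ U → ∑[ T ∈ allTuples n k ] same T U ≤ 1
  once U@(U₁ , U₂) = begin
    ∑[ T ∈ allTuples n k ] same T U
      ≡⟨ ∑-cartesianProduct (allFuns pairs k) (allFuns pairs k) (λ T → same T U) ⟩
    ∑[ T₁ ∈ allFuns pairs k ] ∑[ T₂ ∈ allFuns pairs k ] same (T₁ , T₂) U
      ≡⟨ ∑-cong (allFuns pairs k) (λ T₁ → ∑-*ˡ (allFuns pairs k) (λ T₂ → ⟦ _≗?_ _≟₂_ T₂ U₂ ⟧) ⟦ _≗?_ _≟₂_ T₁ U₁ ⟧) ⟩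
    ∑[ T₁ ∈ allFuns pairs k ] (⟦ _≗?_ _≟₂_ T₁ U₁ ⟧ * ∑[ T₂ ∈ allFuns pairs k ] ⟦ _≗?_ _≟₂_ T₂ U₂ ⟧)
      ≡⟨ ∑-*ʳ (allFuns pairs k) (λ T₁ → ⟦ _≗?_ _≟₂_ T₁ U₁ ⟧) _ ⟩
    (∑[ T₁ ∈ allFuns pairs k ] ⟦ _≗?_ _≟₂_ T₁ U₁ ⟧) * (∑[ T₂ ∈ allFuns pairs k ] ⟦ _≗?_ _≟₂_ T₂ U₂ ⟧)
      ≤⟨ *-mono-≤ (allFuns-once _≟₂_ unique k U₁) (allFuns-once _≟₂_ unique k U₂) ⟩
    1 ∎

-- Greedy embedding of a connected pattern

-- A connected pattern is embedded greedily: start from the two ends of an edge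
-- and keep adding a vertex adjacent to a placed one, at most D choices each.
module Greedy {V A J : Set} (_≟_ : DecidableEquality V)
  (vs : List V) (vs-full : ∀ v → v ∈ vs)
  (js : List J) (js-full : ∀ j → j ∈ js)
  (src dst : J → V) (R : J → A → A → Set)
  (out inn : J → A → List A)
  (out-full : ∀ j {x y} → R j x y → y ∈ out j x)
  (inn-full : ∀ j {x y} → R j x y → x ∈ inn j y)
  (D : ℕ) (1≤D : 1 ≤ D)
  (out≤D : ∀ j x → length (out j x) ≤ D)
  (inn≤D : ∀ j x → length (inn j x) ≤ D)
  where

  open import Data.List.Membership.DecPropositional _≟_ using (_∈?_)

  Hom : (V → A) → Set
  Hom f = ∀ j → R j (f (src j)) (f (dst j))

  -- `U` holds the vertices still to be placed; there the members of `L` carry placeholder values.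
  Covers : List V → List (V → A) → Set
  Covers U L = ∀ f → Hom f → ∃[ g ] g ∈ L × (∀ v → ¬ v ∈ U → f v ≡ g v)

  -- Connectedness is phrased through closed decidable sets instead of paths: `grow` applies it to
  -- the set of placed vertices, and the parity argument for the double cover counts membership in
  -- `S`.
  ConnectedFrom : J → Set₁
  ConnectedFrom j = (S : Pred V _) → Decidable S → (∀ i → S (src i) → S (dst i)) → (∀ i → S (dst i) → S (src i)) →
    S (src j) → S (dst j) → ∀ v → S v

  update : (V → A) → V → A → V → A
  update f v y u with u ≟ v
  ... | yes _ = y
  ... | no  _ = f u

  extend : V → V → (A → List A) → List (V → A) → List (V → A)
  extend u v near = concatMap (λ g → map (update g v) (near (g u)))

  delete : V → List V → List V
  delete v = filter (λ u → ¬? (u ≟ v))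

  length-delete : ∀ {v U} → v ∈ U → length (delete v U) < length U
  length-delete {v} v∈U = filter-notAll (λ u → ¬? (u ≟ v)) _ (Any.map (λ { refl ¬e → ¬e refl }) v∈U)

  ∉-delete : ∀ {v U u} → ¬ u ∈ delete v U → u ≢ v → ¬ u ∈ U
  ∉-delete {v} u∉ u≢v u∈U = u∉ (∈-filter⁺ (λ w → ¬? (w ≟ v)) u∈U u≢v)

  -- As `u` is already placed, `g u` is the true value `f u`, so `f v` is among the candidates in
  -- `near (g u)`.
  extend-covers : ∀ {U L u v} near → Covers U L → ¬ u ∈ U → (∀ f → Hom f → f v ∈ near (f u)) →
    Covers (delete v U) (extend u v near L)
  extend-covers {U} {L} {u} {v} near cov u∉U near-full f hom with cov f hom
  ... | g , g∈L , f≗g = update g v (f v)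
    , ∈-concatMap⁺ (λ g → map (update g v) (near (g u)))
        (Any.map (λ { refl → ∈-map⁺ (update g v) (subst (λ x → f v ∈ near x) (f≗g u u∉U) (near-full f hom)) }) g∈L)
    , agree
    where
    agree : ∀ w → ¬ w ∈ delete v U → f w ≡ update g v (f v) w
    agree w w∉ with w ≟ v
    ... | yes refl = refl
    ... | no w≢v   = f≗g w (∉-delete w∉ w≢v)

  -- Induction on the bound `s` for the number of unplaced vertices: each round places one end of an
  -- edge whose other end is already placed, which multiplies the list by at most `D`.
  grow : ∀ j → ConnectedFrom j → ∀ s U → length U ≤ s → ¬ src j ∈ U → ¬ dst j ∈ U → ∀ L → Covers U L →
    ∃[ L′ ] length L′ ≤ length L * D ^ s × Covers [] L′
  -- Rounds may be left over when everything is placed; `1 ≤ D` makes the surplus factor `D ^ s`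
  -- harmless.
  grow j conn s [] _ _ _ L cov = L , m≤m*n (length L) (D ^ s) {{>-nonZero (m^n>0 D {{>-nonZero 1≤D}} s)}} , cov
  grow j conn (suc s) U@(w ∷ _) |U|≤s a∉ b∉ L cov
    with Any.any? (λ i → ((¬? (src i ∈? U)) ×-dec (dst i ∈? U)) ⊎-dec ((src i ∈? U) ×-dec (¬? (dst i ∈? U)))) js
  -- Without a crossing edge the placed vertices form a closed set containing both ends of `j`,
  -- hence everything, although `w` is unplaced.
  ... | no closed = contradiction (here refl) (conn (λ v → ¬ v ∈ U) (λ v → ¬? (v ∈? U)) forth back a∉ b∉ w)
    where
    forth : ∀ i → ¬ src i ∈ U → ¬ dst i ∈ U
    forth i s∉ d∈ = closed (Any.map (λ { refl → inj₁ (s∉ , d∈) }) (js-full i))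
    back : ∀ i → ¬ dst i ∈ U → ¬ src i ∈ U
    back i d∉ s∈ = closed (Any.map (λ { refl → inj₂ (s∈ , d∉) }) (js-full i))
  ... | yes crossing = step (Any.satisfied crossing)
    where
    proceed : ∀ {u v} near → ¬ u ∈ U → v ∈ U → (∀ f → Hom f → f v ∈ near (f u)) → (∀ x → length (near x) ≤ D) →
      ∃[ L′ ] length L′ ≤ length L * D ^ suc s × Covers [] L′
    proceed {u} {v} near u∉ v∈ near-full near≤D with
      grow j conn s (delete v U) (s≤s⁻¹ (≤-trans (length-delete v∈) |U|≤s))
        (λ p → a∉ (proj₁ (∈-filter⁻ (λ w → ¬? (w ≟ v)) p))) (λ p → b∉ (proj₁ (∈-filter⁻ (λ w → ¬? (w ≟ v)) p)))
        (extend u v near L) (extend-covers near cov u∉ near-full)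
    ... | L′ , |L′| , cov′ = L′ , bound , cov′
      where
      open ≤-Reasoning
      bound : length L′ ≤ length L * (D * D ^ s)
      bound = begin
        length L′                        ≤⟨ |L′| ⟩
        length (extend u v near L) * D ^ s ≤⟨ *-monoˡ-≤ (D ^ s) (length-concatMap≤ _ (λ g → ≤-trans (≤-reflexive (length-map (update g v) (near (g u)))) (near≤D (g u))) L) ⟩
        length L * D * D ^ s             ≡⟨ *-assoc (length L) D (D ^ s) ⟩
        length L * (D * D ^ s)           ∎
    step : ∃[ i ] ((¬ src i ∈ U × dst i ∈ U) ⊎ (src i ∈ U × ¬ dst i ∈ U)) →
      ∃[ L′ ] length L′ ≤ length L * D ^ suc s × Covers [] L′
    step (i , inj₁ (s∉ , d∈)) = proceed (out i) s∉ d∈ (λ f hom → out-full i (hom i)) (out≤D i)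
    step (i , inj₂ (s∈ , d∉)) = proceed (inn i) d∉ s∈ (λ f hom → inn-full i (hom i)) (inn≤D i)

  -- The two ends of `j` are placed together, by an entry of `arcs`; this leaves `s` of the `2 + s`
  -- vertices for `grow`.
  homs-covered : ∀ j → src j ≢ dst j → ConnectedFrom j → ∀ s → length vs ≡ 2 + s →
    (arcs : List (A × A)) → (∀ {x y} → R j x y → (x , y) ∈ arcs) →
    ∃[ L ] length L ≤ length arcs * D ^ s × (∀ f → Hom f → ∃[ g ] g ∈ L × (∀ v → f v ≡ g v))
  homs-covered j a≢b conn s |vs| arcs arcs-full with
    grow j conn s U₀ |U₀|≤s a∉ b∉ L₀ cov₀
    where
    a = src j
    b = dst j
    U₀ = delete b (delete a vs)
    b∈ : b ∈ delete a vs
    b∈ = ∈-filter⁺ (λ w → ¬? (w ≟ a)) (vs-full b) (λ b≡a → a≢b (sym b≡a))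
    |U₀|≤s : length U₀ ≤ s
    |U₀|≤s = s≤s⁻¹ (≤-trans (length-delete b∈) (s≤s⁻¹ (subst (length (delete a vs) <_) |vs| (length-delete (vs-full a)))))
    b∉ : ¬ b ∈ U₀
    b∉ p = proj₂ (∈-filter⁻ (λ w → ¬? (w ≟ b)) {xs = delete a vs} p) refl
    a∉ : ¬ a ∈ U₀
    a∉ p = proj₂ (∈-filter⁻ (λ w → ¬? (w ≟ a)) {xs = vs} (proj₁ (∈-filter⁻ (λ w → ¬? (w ≟ b)) p))) refl
    -- The default value `x` is the intended one at `a`; at the vertices of `U₀` it is a
    -- placeholder.
    place : A × A → V → A
    place (x , y) = update (λ _ → x) b y
    L₀ = map place arcs
    cov₀ : Covers U₀ L₀
    cov₀ f hom = place (f a , f b) , ∈-map⁺ place (arcs-full (hom j)) , agree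
      where
      agree : ∀ v → ¬ v ∈ U₀ → f v ≡ place (f a , f b) v
      agree v v∉ with v ≟ b
      ... | yes refl = refl
      ... | no v≢b with v ≟ a
      ...   | yes refl = refl
      ...   | no v≢a   = contradiction (vs-full v) (∉-delete (∉-delete v∉ v≢b) v≢a)
  ... | L , |L| , cov = L , subst (λ l → length L ≤ l * D ^ s) (length-map _ arcs) |L|
    , λ f hom → let g , g∈ , e = cov f hom in g , g∈ , λ v → e v λ ()

-- Collision probabilities in the hash family

∷-injective : ∀ {A : Set} {r} {x : A} {f : Fin r → A} → (∀ l → x ≢ f l) → Injective _≡_ _≡_ f → Injective _≡_ _≡_ (x VF.∷ f)
∷-injective x∉ inj {zero}  {zero}  e = refl
∷-injective x∉ inj {zero}  {suc l} e = contradiction e (x∉ l)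
∷-injective x∉ inj {suc l} {zero}  e = contradiction (sym e) (x∉ l)
∷-injective x∉ inj {suc l} {suc m} e = cong suc (inj e)

module Collisions {n C N r₀ : ℕ} .{{_ : NonZero C}} (fam : Fin N → Fin n → Fin C) (indep : Independent n C N r₀ fam)
  {Q : Fin N → Set} (Q? : Decidable Q) where

  private
    agree? : ∀ {r} (xs : Fin r → Fin n) (cs : Fin r → Fin C) → Decidable (λ i → ∀ l → fam i (xs l) ≡ cs l)
    agree? xs cs i = F.all? (λ l → fam i (xs l) F.≟ cs l)

  -- The event `Q` lies in the union of the events that `xs` receives the colours `cs`, and
  -- independence gives each of these exactly N / C^r members.
  union-bound : ∀ {r} → r ≤ r₀ → (xs : Fin r → Fin n) → Injective _≡_ _≡_ xs → (css : List (Fin r → Fin C)) →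
    (∀ i → Q i → ∃[ cs ] cs ∈ css × (∀ l → fam i (xs l) ≡ cs l)) →
    ∑[ i ∈ allFin N ] ⟦ Q? i ⟧ * C ^ r ≤ length css * N
  union-bound {r} r≤ xs inj css cover = begin
    ∑[ i ∈ allFin N ] ⟦ Q? i ⟧ * C ^ r
      ≤⟨ *-monoˡ-≤ (C ^ r) (∑-mono (allFin N) hit) ⟩
    ∑[ i ∈ allFin N ] ∑[ cs ∈ css ] ⟦ agree? xs cs i ⟧ * C ^ r
      ≡⟨ cong (_* C ^ r) (∑-swap (allFin N) css (λ i cs → ⟦ agree? xs cs i ⟧)) ⟩
    ∑[ cs ∈ css ] ∑[ i ∈ allFin N ] ⟦ agree? xs cs i ⟧ * C ^ r
      ≡⟨ ∑-*ʳ css (λ cs → ∑[ i ∈ allFin N ] ⟦ agree? xs cs i ⟧) (C ^ r) ⟨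
    ∑[ cs ∈ css ] (∑[ i ∈ allFin N ] ⟦ agree? xs cs i ⟧ * C ^ r)
      ≡⟨ ∑-cong css (λ cs → trans (cong (_* C ^ r) (sym (length-filter≡∑ (agree? xs cs) (allFin N)))) (indep r r≤ xs inj cs)) ⟩
    ∑[ cs ∈ css ] N
      ≡⟨ ∑-const css N ⟩
    length css * N ∎
    where
    open ≤-Reasoning
    hit : ∀ i → ⟦ Q? i ⟧ ≤ ∑[ cs ∈ css ] ⟦ agree? xs cs i ⟧
    hit i with Q? i
    ... | no _ = z≤n
    ... | yes q with cover i q
    ...   | cs , cs∈ , eq = 1≤∑⟦⟧ (λ cs → agree? xs cs i) cs∈ eq

  -- Union bound over the C monochromatic colourings of a pair, each of probability 1/C²; one factor
  -- C cancels.
  collision : 2 ≤ r₀ → ∀ {x y} → x ≢ y → (∀ i → Q i → fam i x ≡ fam i y) →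
    ∑[ i ∈ allFin N ] ⟦ Q? i ⟧ * C ^ 1 ≤ N
  collision 2≤ {x} {y} x≢y eq = *-cancelˡ-≤ C (begin
    C * (p * C ^ 1)             ≡⟨ x∙yz≈y∙xz C p (C ^ 1) ⟩
    p * C ^ 2                   ≤⟨ union-bound 2≤ xs inj css cover ⟩
    length css * N              ≡⟨ cong (_* N) (trans (length-map diag (allFin C)) (length-tabulate {n = C} (λ c → c))) ⟩
    C * N                       ∎)
    where
    open ≤-Reasoning
    p = ∑[ i ∈ allFin N ] ⟦ Q? i ⟧
    xs = x VF.∷ y VF.∷ VF.[]
    inj : Injective _≡_ _≡_ xs
    inj = ∷-injective {r = 1} (λ { zero → x≢y }) (∷-injective (λ ()) (λ { {()} }))
    diag : Fin C → Fin 2 → Fin C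
    diag c _ = c
    css = map diag (allFin C)
    cover : ∀ i → Q i → ∃[ cs ] cs ∈ css × (∀ l → fam i (xs l) ≡ cs l)
    cover i q = diag (fam i x) , ∈-map⁺ diag (∈-allFin (fam i x)) , λ { zero → refl ; (suc zero) → sym (eq i q) }

  -- Union bound over the C² colour patterns (c, c, d, d), each of probability 1/C⁴. The four
  -- vertices must be pairwise distinct for independence to apply.
  double-collision : 4 ≤ r₀ → ∀ {x y x′ y′} → x ≢ y → x′ ≢ y′ → x ≢ x′ → x ≢ y′ → y ≢ x′ → y ≢ y′ →
    (∀ i → Q i → fam i x ≡ fam i y × fam i x′ ≡ fam i y′) →
    ∑[ i ∈ allFin N ] ⟦ Q? i ⟧ * C ^ 2 ≤ N
  double-collision 4≤ {x} {y} {x′} {y′} x≢y x′≢y′ x≢x′ x≢y′ y≢x′ y≢y′ eq = *-cancelˡ-≤ (C ^ 2) {{m^n≢0 C 2}} (begin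
    C ^ 2 * (p * C ^ 2)         ≡⟨ x∙yz≈y∙xz (C ^ 2) p (C ^ 2) ⟩
    p * (C ^ 2 * C ^ 2)         ≡⟨ cong (p *_) (^-distribˡ-+-* C 2 2) ⟨
    p * C ^ 4                   ≤⟨ union-bound 4≤ xs inj css cover ⟩
    length css * N              ≡⟨ cong (_* N) (trans (length-map diag colours²)
                                    (trans (length-cartesianProduct (allFin C) (allFin C))
                                    (trans (cong (λ l → l * l) (length-tabulate {n = C} (λ c → c))) (cong (C *_) (sym (*-identityʳ C)))))) ⟩
    C ^ 2 * N                   ∎)
    where
    open ≤-Reasoning
    p = ∑[ i ∈ allFin N ] ⟦ Q? i ⟧
    xs = x VF.∷ y VF.∷ x′ VF.∷ y′ VF.∷ VF.[]
    inj : Injective _≡_ _≡_ xs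
    inj = ∷-injective {r = 3} (λ { zero → x≢y ; (suc zero) → x≢x′ ; (suc (suc zero)) → x≢y′ })
         (∷-injective {r = 2} (λ { zero → y≢x′ ; (suc zero) → y≢y′ })
         (∷-injective {r = 1} (λ { zero → x′≢y′ }) (∷-injective (λ ()) (λ { {()} }))))
    colours² = cartesianProduct (allFin C) (allFin C)
    diag : Fin C × Fin C → Fin 4 → Fin C
    diag (c , d) = c VF.∷ c VF.∷ d VF.∷ d VF.∷ VF.[]
    css = map diag colours²
    cover : ∀ i → Q i → ∃[ cs ] cs ∈ css × (∀ l → fam i (xs l) ≡ cs l)
    cover i q = diag (fam i x , fam i x′)
      , ∈-map⁺ diag (∈-cartesianProduct⁺ (∈-allFin (fam i x)) (∈-allFin (fam i x′)))
      , λ { zero → refl ; (suc zero) → sym (proj₁ (eq i q))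
          ; (suc (suc zero)) → refl ; (suc (suc (suc zero))) → sym (proj₂ (eq i q)) }

-- Divisibility of sums, positions and signs

∣∑ : ∀ {A : Set} {d} xs {f : A → ℕ} → (∀ x → d ∣ f x) → d ∣ ∑ xs f
∣∑ []       d∣f = _ ∣0
∣∑ (x ∷ xs) d∣f = ∣m∣n⇒∣m+n (d∣f x) (∣∑ xs d∣f)

length-allFin : ∀ n → length (allFin n) ≡ n
length-allFin n = length-tabulate {n = n} (λ i → i)

∑-allFin-≟ : ∀ {n} (y : Fin n) → ∑[ x ∈ allFin n ] ⟦ x F.≟ y ⟧ ≡ 1
∑-allFin-≟ {n} y = ≤-antisym (∑⟦≟⟧≤1 F._≟_ (allFin⁺ n) y) (1≤∑⟦⟧ (F._≟ y) (∈-allFin y) refl)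

bools-full : ∀ s → s ∈ (false ∷ true ∷ [])
bools-full false = here refl
bools-full true  = there (here refl)

positions-full : ∀ {k} (p : Pos k) → p ∈ positions k
positions-full (j , s) = ∈-cartesianProduct⁺ (∈-allFin j) (bools-full s)

length-positions : ∀ k → length (positions k) ≡ k * 2
length-positions k = trans (length-cartesianProduct (allFin k) (false ∷ true ∷ [])) (cong (_* 2) (length-allFin k))

sign : ∀ {k} → (Fin k → Bool × Bool) → Pos k → Bool
sign σ (j , s) = endOf (σ j) s

-- The sign as seen by one of the two tuples: `true` stands for T₁, and `false` for T₂, where all
-- signs are reversed.
orient : Bool → Bool → Bool
orient true  s = s
orient false s = not s

distinct⇒2≤ : ∀ {t} {x y : Fin t} → x ≢ y → 2 ≤ t
distinct⇒2≤ {suc zero} {zero} {zero} x≢y = contradiction refl x≢y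
distinct⇒2≤ {suc (suc t)} x≢y = s≤s (s≤s z≤n)

-- Degrees and double covers of the pattern graph

module PatternGraph {t k : ℕ} (arc : Fin k → Fin t × Fin t)
  (simple : SimpleH arc) (conn : ConnectedH arc) (noLeaves : NoLeavesH arc) (p₀ : Pos k) where

  a : Pos k → Fin t
  a = aH arc

  closed⇒all : (S : Fin t → Set) → (∀ j → S (a (j , false)) → S (a (j , true))) → (∀ j → S (a (j , true)) → S (a (j , false))) →
    ∀ {b} → S b → ∀ b′ → S b′
  closed⇒all S forth back {b} Sb b′ = walk (conn b b′) Sb
    where
    walk : ∀ {x y} → Star (AdjH arc) x y → S x → S y
    walk ε Sx = Sx
    walk ((j , inj₁ (refl , refl)) ◅ xs) Sx = walk xs (forth j Sx)
    walk ((j , inj₂ (refl , refl)) ◅ xs) Sx = walk xs (back j Sx)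

  2≤t : 2 ≤ t
  2≤t = distinct⇒2≤ (proj₁ simple (proj₁ p₀))

  abstract
    -- The vertices that have a position form a set closed under adjacency, and `p₀` makes it
    -- nonempty. The position found here serves as the reference position of `b`.
    position : ∀ b → ∃[ p ] a p ≡ b
    position = closed⇒all (λ b → ∃[ p ] a p ≡ b) (λ j _ → (j , true) , refl) (λ j _ → (j , false) , refl) (p₀ , refl)

  degree≡∑ : ∀ b → degH arc b ≡ ∑[ p ∈ positions k ] ⟦ a p F.≟ b ⟧
  degree≡∑ b = length-filter≡∑ (λ p → a p F.≟ b) (positions k)

  2≤degree : ∀ b → 2 ≤ degH arc b
  2≤degree b = ≤∧≢⇒< (subst (1 ≤_) (sym (degree≡∑ b)) (1≤∑⟦⟧ (λ p → a p F.≟ b) (positions-full (proj₁ (position b))) (proj₂ (position b))))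
    (λ e → noLeaves b (sym e))

  -- Each position lies at exactly one vertex, so the positions are partitioned by `a`.
  ∑-by-vertex : ∀ (f : Pos k → ℕ) → ∑[ b ∈ allFin t ] ∑[ p ∈ positions k ] (⟦ a p F.≟ b ⟧ * f p) ≡ ∑ (positions k) f
  ∑-by-vertex f = trans (∑-swap (allFin t) (positions k) (λ b p → ⟦ a p F.≟ b ⟧ * f p)) (∑-cong (positions k) λ p → begin
    ∑[ b ∈ allFin t ] (⟦ a p F.≟ b ⟧ * f p) ≡⟨ ∑-*ʳ (allFin t) (λ b → ⟦ a p F.≟ b ⟧) (f p) ⟩
    ∑[ b ∈ allFin t ] ⟦ a p F.≟ b ⟧ * f p   ≡⟨ cong (_* f p) (∑-cong (allFin t) λ b →
                                                ≤-antisym (⟦⟧-mono (a p F.≟ b) (b F.≟ a p) sym) (⟦⟧-mono (b F.≟ a p) (a p F.≟ b) sym)) ⟩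
    ∑[ b ∈ allFin t ] ⟦ b F.≟ a p ⟧ * f p   ≡⟨ cong (_* f p) (∑-allFin-≟ (a p)) ⟩
    1 * f p                                 ≡⟨ *-identityˡ (f p) ⟩
    f p                                     ∎)
    where open ≡-Reasoning

  ∑-degree : ∑[ b ∈ allFin t ] degH arc b ≡ k * 2
  ∑-degree = begin
    ∑[ b ∈ allFin t ] degH arc b
      ≡⟨ ∑-cong (allFin t) (λ b → trans (degree≡∑ b) (∑-cong (positions k) λ p → sym (*-identityʳ ⟦ a p F.≟ b ⟧))) ⟩
    ∑[ b ∈ allFin t ] ∑[ p ∈ positions k ] (⟦ a p F.≟ b ⟧ * 1)
      ≡⟨ ∑-by-vertex (λ _ → 1) ⟩
    ∑[ p ∈ positions k ] 1
      ≡⟨ trans (∑-const (positions k) 1) (*-identityʳ _) ⟩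
    length (positions k)
      ≡⟨ length-positions k ⟩
    k * 2 ∎
    where open ≡-Reasoning

  ∑-2 : ∑[ b ∈ allFin t ] 2 ≡ t * 2
  ∑-2 = trans (∑-const (allFin t) 2) (cong (_* 2) (length-allFin t))

  -- Handshake lemma with all degrees at least 2: 2t ≤ 2k.
  t≤k : t ≤ k
  t≤k = *-cancelʳ-≤ t k 2 (subst₂ _≤_ ∑-2 ∑-degree (∑-mono (allFin t) 2≤degree))

  -- A single vertex of degree above 2 makes the handshake inequality strict. Hence t = k forces H
  -- to be 2-regular.
  t<k : ∀ {b} → degH arc b ≢ 2 → t < k
  t<k {b} deg≢2 = *-cancelʳ-< 2 t k (subst₂ _<_ ∑-2 ∑-degree
    (∑-mono-< 2≤degree (∈-allFin b) (≤∧≢⇒< (2≤degree b) (λ e → deg≢2 (sym e)))))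

  -- The double cover of H has vertices `Fin t × Bool` and two edges over each edge `j`. The type
  -- `Pos k` is reused for these edges: here the Boolean selects one of the two lifts, not an end of
  -- `j`.
  liftSrc liftDst : (Fin k → Bool × Bool) → Pos k → Fin t × Bool
  liftSrc σ (j , r) = a (j , false) , orient r (sign σ (j , false))
  liftDst σ (j , r) = a (j , true)  , orient r (sign σ (j , true))

  -- Count the ends of the lifts (j , true) that lie in S.  A cycle has two ends at
  -- each vertex, and they lie in S together except at b₀; so if only one of the two
  -- vertices above b₀ were in S the count would be odd, although each lift has two ends.
  doubleCover-connected : ∀ {σ b₀} p q → (∀ b → degH arc b ≡ 2) → (∀ p → sign σ p ≡ false → a p ≡ b₀) →
    a p ≡ b₀ → sign σ p ≡ false → a q ≡ b₀ → sign σ q ≡ true →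
    (S : Fin t × Bool → Set) → Decidable S →
    (∀ e → S (liftSrc σ e) → S (liftDst σ e)) → (∀ e → S (liftDst σ e) → S (liftSrc σ e)) →
    S (b₀ , false) → ∀ v → S v
  doubleCover-connected {σ} {b₀} p q deg≡2 only ap≡b₀ σp≡false aq≡b₀ σq≡true S S? forth back S-false =
    λ { (b , true) → proj₁ (both b) ; (b , false) → proj₂ (both b) }
    where
    end : Pos k → Fin t × Bool
    end p = a p , sign σ p

    ends : Fin t → ℕ
    ends b = ∑[ p ∈ positions k ] (⟦ a p F.≟ b ⟧ * ⟦ S? (end p) ⟧)

    ∑-ends-even : 2 ∣ ∑[ b ∈ allFin t ] ends b
    ∑-ends-even = subst (2 ∣_) (sym (trans (∑-by-vertex (λ p → ⟦ S? (end p) ⟧))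
      (∑-cartesianProduct (allFin k) (false ∷ true ∷ []) (λ p → ⟦ S? (end p) ⟧))))
      (∣∑ (allFin k) λ j → subst (λ x → 2 ∣ x + (⟦ S? (end (j , true)) ⟧ + 0)) (same j)
        (m∣m*n {2} ⟦ S? (end (j , true)) ⟧))
      where
      same : ∀ j → ⟦ S? (end (j , true)) ⟧ ≡ ⟦ S? (end (j , false)) ⟧
      same j = ≤-antisym (⟦⟧-mono (S? _) (S? _) (back (j , true))) (⟦⟧-mono (S? _) (S? _) (forth (j , true)))

    signed : Bool → ℕ
    signed s = ∑[ p ∈ positions k ] (⟦ a p F.≟ b₀ ⟧ * ⟦ sign σ p B.≟ s ⟧)

    1≤signed : ∀ p → a p ≡ b₀ → 1 ≤ signed (sign σ p)
    1≤signed p ap≡b₀ = ≤-trans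
      (≤-reflexive (sym (cong₂ _*_ (⟦⟧-true (a p F.≟ b₀) ap≡b₀) (⟦⟧-true (sign σ p B.≟ sign σ p) refl))))
      (∈⇒≤∑ (λ p′ → ⟦ a p′ F.≟ b₀ ⟧ * ⟦ sign σ p′ B.≟ sign σ p ⟧) (positions-full p))

    signed-total : signed false + signed true ≡ 2
    signed-total = begin
      signed false + signed true
        ≡⟨ ∑-+ (positions k) (λ p → ⟦ a p F.≟ b₀ ⟧ * ⟦ sign σ p B.≟ false ⟧) (λ p → ⟦ a p F.≟ b₀ ⟧ * ⟦ sign σ p B.≟ true ⟧) ⟨
      ∑[ p ∈ positions k ] (⟦ a p F.≟ b₀ ⟧ * ⟦ sign σ p B.≟ false ⟧ + ⟦ a p F.≟ b₀ ⟧ * ⟦ sign σ p B.≟ true ⟧)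
        ≡⟨ ∑-cong (positions k) (λ p → trans (sym (*-distribˡ-+ ⟦ a p F.≟ b₀ ⟧ _ _)) (trans (cong (⟦ a p F.≟ b₀ ⟧ *_) (either (sign σ p))) (*-identityʳ _))) ⟩
      ∑[ p ∈ positions k ] ⟦ a p F.≟ b₀ ⟧
        ≡⟨ degree≡∑ b₀ ⟨
      degH arc b₀
        ≡⟨ deg≡2 b₀ ⟩
      2 ∎
      where
      open ≡-Reasoning
      either : ∀ s → ⟦ s B.≟ false ⟧ + ⟦ s B.≟ true ⟧ ≡ 1
      either false = refl
      either true  = refl

    -- `p` is negative and `q` positive, and `b₀` has only two positions.
    signed-false≡1 : signed false ≡ 1
    signed-false≡1 = ≤-antisym
      (+-cancelʳ-≤ 1 (signed false) 1 (≤-trans (+-monoʳ-≤ (signed false) (subst (λ s → 1 ≤ signed s) σq≡true (1≤signed q aq≡b₀)))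
        (≤-reflexive signed-total)))
      (subst (λ s → 1 ≤ signed s) σp≡false (1≤signed p ap≡b₀))

    ends-b₀ : ¬ S (b₀ , true) → ends b₀ ≡ 1
    ends-b₀ ¬S-true = trans (∑-cong (positions k) same) signed-false≡1
      where
      same : ∀ p → ⟦ a p F.≟ b₀ ⟧ * ⟦ S? (end p) ⟧ ≡ ⟦ a p F.≟ b₀ ⟧ * ⟦ sign σ p B.≟ false ⟧
      same p with a p F.≟ b₀ | sign σ p
      ... | no _     | _     = refl
      ... | yes refl | false = cong (_+ 0) (⟦⟧-true (S? _) S-false)
      ... | yes refl | true  = cong (_+ 0) (⟦⟧-false (S? _) ¬S-true)

    -- Away from `b₀` all signs are positive, so both ends counted over `b` are the same vertex
    -- `(b , true)`.
    ends-even : ∀ b → b ≢ b₀ → 2 ∣ ends b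
    ends-even b b≢b₀ = subst (2 ∣_) (sym (trans (∑-cong (positions k) same)
      (trans (∑-*ʳ (positions k) (λ p → ⟦ a p F.≟ b ⟧) ⟦ S? (b , true) ⟧)
      (cong (_* ⟦ S? (b , true) ⟧) (trans (sym (degree≡∑ b)) (deg≡2 b))))))
      (m∣m*n {2} ⟦ S? (b , true) ⟧)
      where
      same : ∀ p → ⟦ a p F.≟ b ⟧ * ⟦ S? (end p) ⟧ ≡ ⟦ a p F.≟ b ⟧ * ⟦ S? (b , true) ⟧
      same p with a p F.≟ b | sign σ p in eq
      ... | no _     | _     = refl
      ... | yes refl | false = contradiction (only p eq) b≢b₀
      ... | yes refl | true  = refl

    S-true : S (b₀ , true)
    S-true with S? (b₀ , true)
    ... | yes Sb = Sb
    -- Adding 1 at `b₀` alone makes every summand even. As the sum of `ends` is even too, 2 would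
    -- divide the added 1.
    ... | no ¬Sb = contradiction (subst (2 ∣_) (∑-allFin-≟ b₀) (∣m+n∣m⇒∣n ∑-even ∑-ends-even)) λ { (divides zero ()) ; (divides (suc _) ()) }
      where
      even : ∀ b → 2 ∣ ends b + ⟦ b F.≟ b₀ ⟧
      even b with b F.≟ b₀
      ... | yes refl = subst (λ e → 2 ∣ e + 1) (sym (ends-b₀ ¬Sb)) ∣-refl
      ... | no b≢b₀  = subst (2 ∣_) (sym (+-identityʳ (ends b))) (ends-even b b≢b₀)
      ∑-even : 2 ∣ ∑ (allFin t) ends + ∑[ b ∈ allFin t ] ⟦ b F.≟ b₀ ⟧
      ∑-even = subst (2 ∣_) (∑-+ (allFin t) ends (λ b → ⟦ b F.≟ b₀ ⟧)) (∣∑ (allFin t) even)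

    both : ∀ b → S (b , true) × S (b , false)
    -- The two lifts of an edge match the two vertices above one end with the two above the other,
    -- so having both in `S` passes to neighbours.
    both = closed⇒all (λ b → S (b , true) × S (b , false))
      (λ j → transfer (forth (j , true)) (forth (j , false)))
      (λ j → transfer (back (j , true)) (back (j , false)))
      (S-true , S-false)
      where
      transfer : ∀ {b b′ s s′} → (S (b , s) → S (b′ , s′)) → (S (b , not s) → S (b′ , not s′)) →
        S (b , true) × S (b , false) → S (b′ , true) × S (b′ , false)
      transfer {s = true}  {true}  f g (x , y) = f x , g y
      transfer {s = true}  {false} f g (x , y) = g y , f x
      transfer {s = false} {true}  f g (x , y) = f y , g x
      transfer {s = false} {false} f g (x , y) = g x , f y

-- Counting the lifts in G

∈⇒≤max : ∀ {A : Set} (f : A → ℕ) {xs y} → y ∈ xs → f y ≤ foldr _⊔_ 0 (map f xs)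
∈⇒≤max f {x ∷ xs} (here refl) = m≤m⊔n (f x) _
∈⇒≤max f {x ∷ xs} (there y∈)  = ≤-trans (∈⇒≤max f y∈) (m≤n⊔m (f x) _)

D^[r*2]≡[D*D]^r : ∀ D r → D ^ (r * 2) ≡ (D * D) ^ r
D^[r*2]≡[D*D]^r D zero    = refl
D^[r*2]≡[D*D]^r D (suc r) = trans (sym (*-assoc D D _)) (cong (D * D *_) (D^[r*2]≡[D*D]^r D r))

pick : {A : Set} → A × A → Bool → A
pick (x , y) true  = x
pick (x , y) false = y

arrange : {A : Set} → Bool → A × A → A × A
arrange true  (x , y) = x , y
arrange false (x , y) = y , x

arrange-pick : ∀ {A : Set} s (P : A × A) → arrange s (pick P s , pick P (not s)) ≡ P
arrange-pick true  P = refl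
arrange-pick false P = refl

module Embeddings {t k : ℕ} (arc : Fin k → Fin t × Fin t)
  (simple : SimpleH arc) (conn : ConnectedH arc) (noLeaves : NoLeavesH arc) (p₀ : Pos k)
  {n : ℕ} (E : Fin n → Fin n → Bool) (graph : SimpleGraph n E)
  (D : ℕ) (1≤D : 1 ≤ D) (Δ≤D : maxDegree n E ≤ D)
  where

  open PatternGraph arc simple conn noLeaves p₀

  Arc : Fin n → Fin n → Set
  Arc v w = E v w ≡ true

  Arc-sym : ∀ {v w} → Arc v w → Arc w v
  Arc-sym {v} {w} = trans (proj₁ graph w v)

  nbrs : Fin n → List (Fin n)
  nbrs v = filter (λ w → E v w B.≟ true) (allFin n)

  nbrs-full : ∀ {v w} → Arc v w → w ∈ nbrs v
  nbrs-full {v} {w} vw = ∈-filter⁺ (λ w → E v w B.≟ true) (∈-allFin w) vw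

  |nbrs|≤D : ∀ v → length (nbrs v) ≤ D
  |nbrs|≤D v = ≤-trans (∈⇒≤max (degG n E) (∈-allFin v)) Δ≤D

  arcs : List (Fin n × Fin n)
  arcs = filter (λ vw → E (proj₁ vw) (proj₂ vw) B.≟ true) (cartesianProduct (allFin n) (allFin n))

  arcs-full : ∀ {v w} → Arc v w → (v , w) ∈ arcs
  arcs-full {v} {w} vw = ∈-filter⁺ (λ vw → E (proj₁ vw) (proj₂ vw) B.≟ true) (∈-cartesianProduct⁺ (∈-allFin v) (∈-allFin w)) vw

  IsLift : (Fin k → Bool × Bool) → (Fin t × Bool → Fin n) → Set
  IsLift σ f = ∀ e → Arc (f (liftSrc σ e)) (f (liftDst σ e))

  CoversLifts : (Fin k → Bool × Bool) → List (Fin t × Bool → Fin n) → Set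
  CoversLifts σ L = ∀ f → IsLift σ f → ∃[ g ] g ∈ L × (∀ v → f v ≡ g v)

  -- b ↦ (f (b , true) , f (b , false)) turns a lift into a homomorphism, twisted by the signs,
  -- from H to the tensor square of G, which has m² arcs and maximum degree at most D².
  module _ (σ : Fin k → Bool × Bool) where

    src dst : Fin k → Fin t
    src j = a (j , false)
    dst j = a (j , true)

    srcSign dstSign : Fin k → Bool
    srcSign j = sign σ (j , false)
    dstSign j = sign σ (j , true)

    Arc² : Fin k → Fin n × Fin n → Fin n × Fin n → Set
    Arc² j P Q = ∀ r → Arc (pick P (orient r (srcSign j))) (pick Q (orient r (dstSign j)))

    -- The component of `P` of sign `s` has to be adjacent to the component of sign `s′` of the new
    -- pair, and likewise for the opposite signs; `arrange` puts the two chosen neighbours in order.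
    nbrs² : Bool → Bool → Fin n × Fin n → List (Fin n × Fin n)
    nbrs² s s′ P = map (arrange s′) (cartesianProduct (nbrs (pick P s)) (nbrs (pick P (not s))))

    nbrs²-full : ∀ s s′ {P Q} → Arc (pick P s) (pick Q s′) → Arc (pick P (not s)) (pick Q (not s′)) → Q ∈ nbrs² s s′ P
    nbrs²-full s s′ {P} {Q} e e′ = subst (_∈ nbrs² s s′ P) (arrange-pick s′ Q)
      (∈-map⁺ (arrange s′) (∈-cartesianProduct⁺ (nbrs-full e) (nbrs-full e′)))

    |nbrs²|≤D² : ∀ s s′ P → length (nbrs² s s′ P) ≤ D * D
    |nbrs²|≤D² s s′ P = begin
      length (nbrs² s s′ P)                               ≡⟨ trans (length-map (arrange s′) (cartesianProduct (nbrs (pick P s)) _)) (length-cartesianProduct (nbrs (pick P s)) _) ⟩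
      length (nbrs (pick P s)) * length (nbrs (pick P (not s))) ≤⟨ *-mono-≤ (|nbrs|≤D (pick P s)) (|nbrs|≤D (pick P (not s))) ⟩
      D * D ∎
      where open ≤-Reasoning

    arcs² : Bool → Bool → List ((Fin n × Fin n) × (Fin n × Fin n))
    arcs² s s′ = map (λ ((x , x′) , (y , y′)) → arrange s (x , y) , arrange s′ (x′ , y′)) (cartesianProduct arcs arcs)

    arcs²-full : ∀ s s′ {P Q} → Arc (pick P s) (pick Q s′) → Arc (pick P (not s)) (pick Q (not s′)) → (P , Q) ∈ arcs² s s′
    arcs²-full s s′ {P} {Q} e e′ = subst (_∈ arcs² s s′) (cong₂ _,_ (arrange-pick s P) (arrange-pick s′ Q))
      (∈-map⁺ (λ ((x , x′) , (y , y′)) → arrange s (x , y) , arrange s′ (x′ , y′)) (∈-cartesianProduct⁺ (arcs-full e) (arcs-full e′)))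

    -- Only the connectedness of H is used, so this holds for every sign pattern: m² choices for the
    -- first edge and D² for each of the other t - 2 vertices.
    lifts-covered : ∀ r → t ≡ 2 + r → ∃[ L ] length L ≤ numArcs n E ^ 2 * (D * D) ^ r × CoversLifts σ L
    lifts-covered r t≡2+r with
      homs-covered (proj₁ p₀) (proj₁ simple (proj₁ p₀))
        (λ S S? forth back Sa _ → closed⇒all S forth back Sa) r (trans (length-allFin t) t≡2+r)
        (arcs² s s′) (λ {P} e → arcs²-full s s′ {P} (e true) (e false))
      where
      s = srcSign (proj₁ p₀)
      s′ = dstSign (proj₁ p₀)
      open Greedy F._≟_ (allFin t) ∈-allFin (allFin k) ∈-allFin src dst Arc²
        (λ j → nbrs² (srcSign j) (dstSign j))
        (λ j → nbrs² (dstSign j) (srcSign j))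
        (λ j {P} e → nbrs²-full (srcSign j) (dstSign j) {P} (e true) (e false))
        (λ j {P} {Q} e → nbrs²-full (dstSign j) (srcSign j) {Q} (Arc-sym (e true)) (Arc-sym (e false)))
        (D * D) (*-mono-≤ 1≤D 1≤D)
        (λ j → |nbrs²|≤D² (srcSign j) (dstSign j)) (λ j → |nbrs²|≤D² (dstSign j) (srcSign j))
    ... | L , |L| , cov = map uncurried L , bound , covers
      where
      uncurried : (Fin t → Fin n × Fin n) → Fin t × Bool → Fin n
      uncurried F (b , s) = pick (F b) s
      bound : length (map uncurried L) ≤ numArcs n E ^ 2 * (D * D) ^ r
      bound = subst₂ _≤_ (sym (length-map uncurried L))
        (cong (_* (D * D) ^ r) (trans (length-map _ (cartesianProduct arcs arcs))
          (trans (length-cartesianProduct arcs arcs) (cong (numArcs n E *_) (sym (*-identityʳ (numArcs n E)))))))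
        |L|
      pick-pair : ∀ (f : Fin t × Bool → Fin n) v → pick (f (proj₁ v , true) , f (proj₁ v , false)) (proj₂ v) ≡ f v
      pick-pair f (b , true)  = refl
      pick-pair f (b , false) = refl
      covers : CoversLifts σ (map uncurried L)
      covers f lift with cov (λ b → f (b , true) , f (b , false))
        (λ j r → subst₂ Arc (sym (pick-pair f (liftSrc σ (j , r)))) (sym (pick-pair f (liftDst σ (j , r)))) (lift (j , r)))
      ... | G , G∈ , F≗G = uncurried G , ∈-map⁺ uncurried G∈ , λ v → trans (sym (pick-pair f v)) (cong (λ P → pick P (proj₂ v)) (F≗G (proj₁ v)))

    -- Here the greedy embedding runs on the double cover itself: one arc of G places two of its 2t
    -- vertices, and the remaining 2(t - 1) cost D each.
    connected-lifts-covered : ∀ p q → (∀ b → degH arc b ≡ 2) → (∀ p′ → sign σ p′ ≡ false → a p′ ≡ a p) →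
      sign σ p ≡ false → a q ≡ a p → sign σ q ≡ true →
      ∀ r → t ≡ suc r → ∃[ L ] length L ≤ numArcs n E ^ 1 * (D * D) ^ r × CoversLifts σ L
    connected-lifts-covered p@(j , s) q deg≡2 only σp≡false aq≡ap σq≡true r t≡1+r with
      homs-covered (j , true) (λ e → proj₁ simple j (cong proj₁ e)) fromEdge (r * 2)
        (trans (length-cartesianProduct (allFin t) (false ∷ true ∷ [])) (cong (_* 2) (trans (length-allFin t) t≡1+r)))
        arcs arcs-full
      where
      open Greedy (≡-dec F._≟_ B._≟_) (cartesianProduct (allFin t) (false ∷ true ∷ []))
        (λ (b , s) → ∈-cartesianProduct⁺ (∈-allFin b) (bools-full s))
        (positions k) positions-full (liftSrc σ) (liftDst σ) (λ _ → Arc) (λ _ → nbrs) (λ _ → nbrs)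
        (λ _ → nbrs-full) (λ _ e → nbrs-full (Arc-sym e)) D 1≤D (λ _ → |nbrs|≤D) (λ _ → |nbrs|≤D)
      pick-end : (S : Fin t × Bool → Set) → ∀ s → S (liftSrc σ (j , true)) → S (liftDst σ (j , true)) → S (a (j , s) , sign σ (j , s))
      pick-end S false Sa Sb = Sa
      pick-end S true  Sa Sb = Sb
      -- The starting edge is the lift of `j` that has the vertex `(a p , false)` as an end, because
      -- `p` is negative; the parity argument starts from that vertex.
      fromEdge : ConnectedFrom (j , true)
      fromEdge S S? forth back Sa Sb = doubleCover-connected p q deg≡2 only refl σp≡false aq≡ap σq≡true S S? forth back
        (subst (λ s′ → S (a p , s′)) σp≡false (pick-end S s Sa Sb))
    ... | L , |L| , cov = L , subst (length L ≤_) (cong₂ _*_ (sym (*-identityʳ (numArcs n E))) (D^[r*2]≡[D*D]^r D r)) |L| , cov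

-- Weighing powers of D and C against m

^-distribʳ-* : ∀ x y r → (x * y) ^ r ≡ x ^ r * y ^ r
^-distribʳ-* x y zero    = refl
^-distribʳ-* x y (suc r) = trans (cong (x * y *_) (^-distribʳ-* x y r)) (interchange x y (x ^ r) (y ^ r))

-- Each of the `r` factors D² takes one C and becomes at most m; C^x is absorbed by m^q; the
-- remaining C^e is left for the collision probability to pay.
weigh-edges : ∀ {m C D} → D * D * C ≤ m → ∀ u r q {x} e → C ^ x ≤ m ^ q →
  m ^ u * (D * D) ^ r * C ^ (r + x + e) ≤ m ^ (u + r + q) * C ^ e
weigh-edges {m} {C} {D} D²C≤m u r q {x} e Cˣ≤mᵠ = begin
  m ^ u * (D * D) ^ r * C ^ (r + x + e)
    ≡⟨ cong (m ^ u * (D * D) ^ r *_) (trans (^-distribˡ-+-* C (r + x) e) (cong (_* C ^ e) (^-distribˡ-+-* C r x))) ⟩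
  m ^ u * (D * D) ^ r * (C ^ r * C ^ x * C ^ e)
    ≡⟨ solve 5 (λ a b c d e → a :* b :* (c :* d :* e) := a :* (b :* c) :* d :* e) refl (m ^ u) ((D * D) ^ r) (C ^ r) (C ^ x) (C ^ e) ⟩
  m ^ u * ((D * D) ^ r * C ^ r) * C ^ x * C ^ e
    ≡⟨ cong (λ y → m ^ u * y * C ^ x * C ^ e) (^-distribʳ-* (D * D) C r) ⟨
  m ^ u * (D * D * C) ^ r * C ^ x * C ^ e
    ≤⟨ *-monoˡ-≤ (C ^ e) (*-mono-≤ (*-monoʳ-≤ (m ^ u) (^-monoˡ-≤ r D²C≤m)) Cˣ≤mᵠ) ⟩
  m ^ u * m ^ r * m ^ q * C ^ e
    ≡⟨ cong (_* C ^ e) (trans (^-distribˡ-+-* m (u + r) q) (cong (_* m ^ q) (^-distribˡ-+-* m u r))) ⟨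
  m ^ (u + r + q) * C ^ e ∎
  where
  open ≤-Reasoning
  open +-*-Solver

2*[t+q]∸t : ∀ t q → 2 * (t + q) ∸ t ≡ t + 2 * q
2*[t+q]∸t t q = trans (cong (_∸ t) (solve 2 (λ t q → con 2 :* (t :+ q) := t :+ (t :+ con 2 :* q)) refl t q)) (m+n∸m≡n t (t + 2 * q))
  where open +-*-Solver

signPairs : List (Bool × Bool)
signPairs = cartesianProduct (false ∷ true ∷ []) (false ∷ true ∷ [])

signPairs-full : ∀ s → s ∈ signPairs
signPairs-full (s , s′) = ∈-cartesianProduct⁺ (bools-full s) (bools-full s′)

-- The expected count, one sign pattern at a time

module Expectation {t k : ℕ} (arc : Fin k → Fin t × Fin t)
  (simple : SimpleH arc) (conn : ConnectedH arc) (noLeaves : NoLeavesH arc) (p₀ : Pos k)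
  {n : ℕ} (E : Fin n → Fin n → Bool) (graph : SimpleGraph n E)
  (D : ℕ) (1≤D : 1 ≤ D) (Δ≤D : maxDegree n E ≤ D)
  {C N : ℕ} (t≤C : t ≤ C) (D²C≤m : D * D * C ≤ numArcs n E) (C³≤m : C ^ 3 ≤ numArcs n E)
  (fam : Fin N → Fin n → Fin C) (indep : Independent n C N (4 * k) fam)
  (dec : ∀ i → Decidable (Counted arc E (fam i)))
  where

  open PatternGraph arc simple conn noLeaves p₀
  open Embeddings arc simple conn noLeaves p₀ E graph D 1≤D Δ≤D

  m : ℕ
  m = numArcs n E

  instance
    C-nonZero : NonZero C
    C-nonZero = >-nonZero (≤-trans (s≤s z≤n) (≤-trans 2≤t t≤C))

  hits : ETuple n k × ETuple n k → ℕ
  hits T = ∑[ i ∈ allFin N ] ⟦ dec i T ⟧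

  ref : Pos k → Pos k
  ref p = proj₁ (position (a p))

  a-ref : ∀ p → a (ref p) ≡ a p
  a-ref p = proj₂ (position (a p))

  agrees : ETuple n k → Pos k → Bool
  agrees T₁ p = does (uAt T₁ p F.≟ uAt T₁ (ref p))

  -- Signs are read off T₁ alone. Thus a negative sign always exhibits two distinct vertices, and
  -- there is no ambiguity when X_b = Y_b.
  signOf : ETuple n k × ETuple n k → Fin k → Bool × Bool
  signOf (T₁ , _) j = agrees T₁ (j , false) , agrees T₁ (j , true)

  HasSign : (Fin k → Bool × Bool) → ETuple n k × ETuple n k → Set
  HasSign σ T = ∀ j → σ j ≡ signOf T j

  hasSign? : ∀ σ → Decidable (HasSign σ)
  hasSign? σ T = _≗?_ (≡-dec B._≟_ B._≟_) σ (signOf T)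

  sign≡agrees : ∀ {σ} T → HasSign σ T → ∀ p → sign σ p ≡ agrees (proj₁ T) p
  sign≡agrees T hs (j , false) = cong proj₁ (hs j)
  sign≡agrees T hs (j , true)  = cong proj₂ (hs j)

  sign-true : ∀ {σ} T p → HasSign σ T → sign σ p ≡ true → uAt (proj₁ T) p ≡ uAt (proj₁ T) (ref p)
  sign-true T p hs σp with uAt (proj₁ T) p F.≟ uAt (proj₁ T) (ref p) | sign≡agrees T hs p
  ... | yes e | _  = e
  ... | no _  | e = contradiction (trans (sym e) σp) λ ()

  sign-false : ∀ {σ} T p → HasSign σ T → sign σ p ≡ false → uAt (proj₁ T) p ≢ uAt (proj₁ T) (ref p)
  sign-false T p hs σp with uAt (proj₁ T) p F.≟ uAt (proj₁ T) (ref p) | sign≡agrees T hs p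
  ... | no ¬e | _ = ¬e
  ... | yes _ | e = contradiction (trans (sym σp) e) λ ()

  -- A reference position is its own reference. In particular a vertex with a negative position also
  -- has a positive one, as the parity argument requires.
  sign-ref : ∀ {σ} T b → HasSign σ T → sign σ (proj₁ (position b)) ≡ true
  sign-ref {σ} T b hs with sign σ (proj₁ (position b)) in eq
  ... | true  = refl
  ... | false = contradiction (cong (λ b′ → uAt (proj₁ T) (proj₁ (position b′))) (sym (proj₂ (position b)))) (sign-false T (proj₁ (position b)) hs eq)

  -- The lift belonging to T: it sends `(b , true)` to X_b and `(b , false)` to Y_b.
  frame : ETuple n k × ETuple n k → Fin t × Bool → Fin n
  frame (T₁ , T₂) (b , true)  = uAt T₁ (proj₁ (position b))
  frame (T₁ , T₂) (b , false) = uAt T₂ (proj₁ (position b))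

  tupleOf : (Fin k → Bool × Bool) → (Fin t × Bool → Fin n) → ETuple n k × ETuple n k
  tupleOf σ f = (λ j → f (liftSrc σ (j , true)) , f (liftDst σ (j , true)))
              , (λ j → f (liftSrc σ (j , false)) , f (liftDst σ (j , false)))

  -- Condition 1 rules out a negative sign. Under Condition 3 the sign tells whether `p` and its
  -- reference carry x and y the same way round.
  decode : ∀ {σ} T → HasSign σ T → (∀ b → Condition1 arc (proj₁ T) (proj₂ T) b ⊎ Condition3 arc (proj₁ T) (proj₂ T) b) →
    ∀ p → uAt (proj₁ T) p ≡ frame T (a p , sign σ p) × uAt (proj₂ T) p ≡ frame T (a p , not (sign σ p))
  decode {σ} T@(T₁ , T₂) hs conds p with conds (a p) | sign σ p in eq
  ... | inj₁ c₁ | true  = c₁ p (ref p) refl (a-ref p)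
  ... | inj₁ c₁ | false = contradiction (proj₁ (c₁ p (ref p) refl (a-ref p))) (sign-false T p hs eq)
  ... | inj₂ (x , y , c₃) | s with c₃ p refl | c₃ (ref p) (a-ref p) | s
  ...   | inj₁ (v , w) | inj₁ (v′ , w′) | true  = trans v (sym v′) , trans w (sym w′)
  ...   | inj₂ (v , w) | inj₂ (v′ , w′) | true  = trans v (sym v′) , trans w (sym w′)
  -- Opposite ways round but the same vertex in T₁: this forces x = y, so the second components
  -- agree as well.
  ...   | inj₁ (v , w) | inj₂ (v′ , w′) | true  = let e = sign-true T p hs eq in e , trans w (trans (sym v′) (trans (sym e) (trans v (sym w′))))
  ...   | inj₂ (v , w) | inj₁ (v′ , w′) | true  = let e = sign-true T p hs eq in e , trans w (trans (sym v′) (trans (sym e) (trans v (sym w′))))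
  ...   | inj₁ (v , w) | inj₁ (v′ , w′) | false = contradiction (trans v (sym v′)) (sign-false T p hs eq)
  ...   | inj₂ (v , w) | inj₂ (v′ , w′) | false = contradiction (trans v (sym v′)) (sign-false T p hs eq)
  ...   | inj₁ (v , w) | inj₂ (v′ , w′) | false = trans v (sym w′) , trans w (sym v′)
  ...   | inj₂ (v , w) | inj₁ (v′ , w′) | false = trans v (sym w′) , trans w (sym v′)

  someHit : ∀ T → 0 < hits T → ∃[ i ] Counted arc E (fam i) T
  someHit T 0<hits with ∑-pos (allFin N) (λ i → ⟦ dec i T ⟧) 0<hits
  ... | i , 0<⟦⟧ = i , ⟦⟧-pos (dec i T) 0<⟦⟧

  Covers : (Fin k → Bool × Bool) → List (ETuple n k × ETuple n k) → Set
  Covers σ L = ∀ T → HasSign σ T × 0 < hits T →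
    ∃[ U ] U ∈ L × (∀ j → proj₁ T j ≡ proj₁ U j) × (∀ j → proj₂ T j ≡ proj₂ U j)

  -- By `decode` the two lifts of an edge `j` go to the `j`-th arcs of T₁ and T₂. So the frame is a
  -- lift, and `tupleOf σ` recovers T from it.
  lifts⇒covers : ∀ {σ L} → CoversLifts σ L → Covers σ (map (tupleOf σ) L)
  lifts⇒covers {σ} {L} cov T (hs , 0<hits) with someHit T 0<hits
  ... | i , arcs₁ , arcs₂ , _ , _ , conds , _ = covered (cov (frame T) isLift)
    where
    dec₁ : ∀ p → uAt (proj₁ T) p ≡ frame T (a p , sign σ p)
    dec₁ p = proj₁ (decode T hs conds p)
    dec₂ : ∀ p → uAt (proj₂ T) p ≡ frame T (a p , not (sign σ p))
    dec₂ p = proj₂ (decode T hs conds p)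
    isLift : IsLift σ (frame T)
    isLift (j , true)  = subst₂ Arc (dec₁ (j , false)) (dec₁ (j , true)) (arcs₁ j)
    isLift (j , false) = subst₂ Arc (dec₂ (j , false)) (dec₂ (j , true)) (arcs₂ j)
    covered : (∃[ g ] g ∈ L × (∀ v → frame T v ≡ g v)) →
      ∃[ U ] U ∈ map (tupleOf σ) L × (∀ j → proj₁ T j ≡ proj₁ U j) × (∀ j → proj₂ T j ≡ proj₂ U j)
    covered (g , g∈ , frame≗g) = tupleOf σ g , ∈-map⁺ (tupleOf σ) g∈
      , (λ j → cong₂ _,_ (trans (dec₁ (j , false)) (frame≗g _)) (trans (dec₁ (j , true)) (frame≗g _)))
      , (λ j → cong₂ _,_ (trans (dec₂ (j , false)) (frame≗g _)) (trans (dec₂ (j , true)) (frame≗g _)))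

  same-colour : ∀ T i → Counted arc E (fam i) T → ∀ {p q} → a p ≡ a q →
    fam i (uAt (proj₁ T) p) ≡ fam i (uAt (proj₁ T) q)
  same-colour T i (_ , _ , (c , _ , col) , _) {p} {q} e = trans (col p) (trans (cong c e) (sym (col q)))

  -- One colouring that counts T suffices: it gives different colours to the vertices placed at
  -- different vertices of H. The conclusion no longer mentions the colouring.
  distinct : ∀ T i → Counted arc E (fam i) T → ∀ {p q} → a p ≢ a q → uAt (proj₁ T) p ≢ uAt (proj₁ T) q
  distinct T i (_ , _ , (c , c-inj , col) , _) {p} {q} ap≢aq e =
    ap≢aq (c-inj (trans (sym (col p)) (trans (cong (fam i) e) (col q))))

  1≤k : 1 ≤ k
  1≤k = ≤-trans (s≤s z≤n) (≤-trans 2≤t t≤k)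

  4≤4k : 4 ≤ 4 * k
  4≤4k = *-monoʳ-≤ 4 1≤k

  hits-once : ∀ {σ p} → sign σ p ≡ false → ∀ T → HasSign σ T → hits T * C ^ 1 ≤ N
  hits-once {σ} {p} σp T hs = collision (≤-trans (s≤s (s≤s z≤n)) 4≤4k) (sign-false T p hs σp)
    (λ i counted → same-colour T i counted {p} {ref p} (sym (a-ref p)))
    where open Collisions fam indep (λ i → dec i T)

  -- Within each colliding pair the vertices differ by the sign; across the pairs they differ by
  -- `distinct`, which takes the colouring provided by `0 < hits T`.
  hits-twice : ∀ {σ p q} → sign σ p ≡ false → sign σ q ≡ false → a p ≢ a q → ∀ T → HasSign σ T → 0 < hits T → hits T * C ^ 2 ≤ N
  hits-twice {σ} {p} {q} σp σq ap≢aq T hs 0<hits with someHit T 0<hits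
  ... | i₀ , counted₀ = double-collision 4≤4k (sign-false T p hs σp) (sign-false T q hs σq)
    (apart p q ap≢aq)
    (apart p (ref q) (λ e → ap≢aq (trans e (a-ref q))))
    (apart (ref p) q (λ e → ap≢aq (trans (sym (a-ref p)) e)))
    (apart (ref p) (ref q) (λ e → ap≢aq (trans (sym (a-ref p)) (trans e (a-ref q)))))
    (λ i counted → same-colour T i counted {p} {ref p} (sym (a-ref p)) , same-colour T i counted {q} {ref q} (sym (a-ref q)))
    where
    open Collisions fam indep (λ i → dec i T)
    apart : ∀ p q → a p ≢ a q → uAt (proj₁ T) p ≢ uAt (proj₁ T) q
    apart p q = distinct T i₀ counted₀ {p} {q}

  -- If all signs were positive, `decode` would give Condition 1 at every vertex, which counted
  -- tuples violate.
  someSwitch : ∀ {σ} T → HasSign σ T → 0 < hits T → ∃[ p ] sign σ p ≡ false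
  someSwitch {σ} T hs 0<hits with Any.any? (λ p → sign σ p B.≟ false) (positions k)
  ... | yes any = Any.satisfied any
  ... | no none with someHit T 0<hits
  ...   | i , _ , _ , _ , _ , conds , ¬all₁ = contradiction (λ b p q → λ { refl aq≡b → allEqual p q aq≡b }) ¬all₁
    where
    all-true : ∀ p → sign σ p ≡ true
    all-true p with sign σ p in eq
    ... | true  = refl
    ... | false = contradiction (Any.map (λ { refl → eq }) (positions-full p)) none
    at : ∀ p → uAt (proj₁ T) p ≡ frame T (a p , true) × uAt (proj₂ T) p ≡ frame T (a p , false)
    at p = subst (λ s → uAt (proj₁ T) p ≡ frame T (a p , s) × uAt (proj₂ T) p ≡ frame T (a p , not s)) (all-true p) (decode T hs conds p)
    allEqual : ∀ p q → a q ≡ a p → uAt (proj₁ T) p ≡ uAt (proj₁ T) q × uAt (proj₂ T) p ≡ uAt (proj₂ T) q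
    allEqual p q e = trans (proj₁ (at p)) (trans (cong (λ b → frame T (b , true)) (sym e)) (sym (proj₁ (at q))))
                   , trans (proj₂ (at p)) (trans (cong (λ b → frame T (b , false)) (sym e)) (sym (proj₂ (at q))))

  Q : ℕ
  Q = C ^ (2 * k ∸ t)

  hitsWith : (Fin k → Bool × Bool) → ℕ
  hitsWith σ = ∑[ T ∈ allTuples n k ] (⟦ hasSign? σ T ⟧ * hits T)

  -- At most `length L` tuples contribute, each with at most N / C^e hits. The factor C^e is carried
  -- on both sides and cancelled, which avoids division.
  hitsWith-bound : ∀ {σ} e {L} → Covers σ L → (∀ T → HasSign σ T → 0 < hits T → hits T * C ^ e ≤ N) →
    length L * Q ≤ m ^ k * C ^ e → hitsWith σ * Q ≤ m ^ k * N
  hitsWith-bound {σ} e {L} cov prob len = *-cancelʳ-≤ _ _ (C ^ e) {{m^n≢0 C e}} (begin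
    hitsWith σ * Q * C ^ e
      ≡⟨ *-assoc (hitsWith σ) Q (C ^ e) ⟩
    hitsWith σ * (Q * C ^ e)
      ≡⟨ trans (cong (hitsWith σ *_) (*-comm Q (C ^ e))) (sym (*-assoc (hitsWith σ) (C ^ e) Q)) ⟩
    hitsWith σ * C ^ e * Q
      ≡⟨ cong (_* Q) (∑-*ʳ (allTuples n k) _ (C ^ e)) ⟨
    ∑[ T ∈ allTuples n k ] (⟦ hasSign? σ T ⟧ * hits T * C ^ e) * Q
      ≤⟨ *-monoˡ-≤ Q (∑-mono (allTuples n k) each) ⟩
    ∑[ T ∈ allTuples n k ] (⟦ hit? T ⟧ * N) * Q
      ≡⟨ cong (_* Q) (∑-*ʳ (allTuples n k) _ N) ⟩
    ∑[ T ∈ allTuples n k ] ⟦ hit? T ⟧ * N * Q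
      ≤⟨ *-monoˡ-≤ Q (*-monoˡ-≤ N (count-covered hit? L cov)) ⟩
    length L * N * Q
      ≡⟨ solve 3 (λ l n q → l :* n :* q := l :* q :* n) refl (length L) N Q ⟩
    length L * Q * N
      ≤⟨ *-monoˡ-≤ N len ⟩
    m ^ k * C ^ e * N
      ≡⟨ solve 3 (λ l n q → l :* n :* q := l :* q :* n) refl (m ^ k) (C ^ e) N ⟩
    m ^ k * N * C ^ e ∎)
    where
    open ≤-Reasoning
    open +-*-Solver using (solve; _:*_; _:=_)
    hit? : ∀ T → Dec (HasSign σ T × 0 < hits T)
    hit? T = hasSign? σ T ×-dec (1 ≤? hits T)
    each : ∀ T → ⟦ hasSign? σ T ⟧ * hits T * C ^ e ≤ ⟦ hit? T ⟧ * N
    each T with hasSign? σ T | 1 ≤? hits T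
    ... | no _   | _     = z≤n
    ... | yes hs | yes h = subst₂ _≤_ (cong (_* C ^ e) (sym (+-identityʳ (hits T)))) (sym (+-identityʳ N)) (prob T hs h)
    ... | yes hs | no ¬h = ≤-reflexive (cong (λ x → (x + 0) * C ^ e) (n<1⇒n≡0 (≰⇒> ¬h)))

  impossible : ∀ {σ} → (∀ T → HasSign σ T → ¬ 0 < hits T) → hitsWith σ * Q ≤ m ^ k * N
  impossible none = hitsWith-bound 0 {[]} (λ T (hs , h) → contradiction h (none T hs)) (λ T hs h → contradiction h (none T hs)) z≤n

  q : ℕ
  q = k ∸ t

  k≡t+q : k ≡ t + q
  k≡t+q = sym (m+[n∸m]≡n t≤k)

  C^2q≤m^q : C ^ (2 * q) ≤ m ^ q
  C^2q≤m^q = subst (_≤ m ^ q) (^-*-assoc C 2 q) (^-monoˡ-≤ q (≤-trans (^-monoʳ-≤ C (n≤1+n 2)) C³≤m))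

  -- Now q ≥ 1, so 1 + 2q ≤ 3q and `C³≤m` applies q times.
  C^1+2q≤m^q : t < k → C ^ (1 + 2 * q) ≤ m ^ q
  C^1+2q≤m^q t<k = ≤-trans (^-monoʳ-≤ C (+-monoˡ-≤ (2 * q) (m<n⇒0<n∸m t<k)))
    (subst (_≤ m ^ q) (^-*-assoc C 3 q) (^-monoˡ-≤ q C³≤m))

  -- The exponent t + 2q is 2k - t. It is split into `r` for the factors D², `x` for m^q and `e` for
  -- the collisions.
  lift-bound : ∀ {σ} u r e {x L} → C ^ x ≤ m ^ q → t ≡ u + r → r + x + e ≡ t + 2 * q →
    length L ≤ m ^ u * (D * D) ^ r → CoversLifts σ L →
    (∀ T → HasSign σ T → 0 < hits T → hits T * C ^ e ≤ N) → hitsWith σ * Q ≤ m ^ k * N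
  lift-bound {σ} u r e {x} {L} Cˣ t≡u+r exponent |L| cov prob = hitsWith-bound e (lifts⇒covers cov) prob (begin
    length (map (tupleOf σ) L) * C ^ (2 * k ∸ t)
      ≡⟨ cong₂ _*_ (length-map (tupleOf σ) L) (cong (C ^_) (trans (cong (λ k → 2 * k ∸ t) k≡t+q) (trans (2*[t+q]∸t t q) (sym exponent)))) ⟩
    length L * C ^ (r + x + e)
      ≤⟨ *-monoˡ-≤ (C ^ (r + x + e)) |L| ⟩
    m ^ u * (D * D) ^ r * C ^ (r + x + e)
      ≤⟨ weigh-edges {D = D} D²C≤m u r q e Cˣ ⟩
    m ^ (u + r + q) * C ^ e
      ≡⟨ cong (λ k → m ^ k * C ^ e) (trans (cong (_+ q) (sym t≡u+r)) (sym k≡t+q)) ⟩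
    m ^ k * C ^ e ∎)
    where open ≤-Reasoning

  -- The exponent t + 2q is split as (t - 2) + 2q + 2 for two switching vertices, (t - 2) + (1 + 2q)
  -- + 1 for one with t < k, and (t - 1) + 2q + 1 for one on a cycle.
  bound-by-sign : ∀ σ → hitsWith σ * Q ≤ m ^ k * N
  bound-by-sign σ with Any.any? (λ p → sign σ p B.≟ false) (positions k)
  ... | no none = impossible λ T hs h → let p , σp = someSwitch T hs h in
    none (Any.map (λ { refl → σp }) (positions-full p))
  ... | yes any with Any.satisfied any
  ...   | p , σp with Any.any? (λ p′ → (sign σ p′ B.≟ false) ×-dec ¬? (a p F.≟ a p′)) (positions k)
  ...     | yes any′ = two (Any.satisfied any′) (lifts-covered σ r t≡2+r)
    where
    r : ℕ
    r = t ∸ 2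
    t≡2+r : t ≡ 2 + r
    t≡2+r = sym (m+[n∸m]≡n 2≤t)
    two : ∃[ p′ ] (sign σ p′ ≡ false × a p ≢ a p′) → ∃[ L ] length L ≤ m ^ 2 * (D * D) ^ r × CoversLifts σ L →
      hitsWith σ * Q ≤ m ^ k * N
    two (p′ , σp′ , ap≢ap′) (L , |L| , cov) = lift-bound 2 r 2 C^2q≤m^q t≡2+r
      (trans (+-comm (r + 2 * q) 2) (cong (_+ 2 * q) (sym t≡2+r))) |L| cov (hits-twice {p = p} {p′} σp σp′ ap≢ap′)
  ...     | no single with suc t ≤? k | sign σ (proj₁ (position (a p))) B.≟ true
  ...       | yes t<k | _ = one (lifts-covered σ r t≡2+r)
    where
    r : ℕ
    r = t ∸ 2
    t≡2+r : t ≡ 2 + r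
    t≡2+r = sym (m+[n∸m]≡n 2≤t)
    one : ∃[ L ] length L ≤ m ^ 2 * (D * D) ^ r × CoversLifts σ L → hitsWith σ * Q ≤ m ^ k * N
    one (L , |L| , cov) = lift-bound 2 r 1 (C^1+2q≤m^q t<k) t≡2+r
      (trans (+-comm (r + (1 + 2 * q)) 1) (trans (cong suc (+-suc r (2 * q))) (cong (_+ 2 * q) (sym t≡2+r)))) |L| cov
      (λ T hs _ → hits-once {p = p} σp T hs)
  -- A pattern that is negative at a reference position is the pattern of no tuple.
  ...       | no _ | no σref = impossible λ T hs _ → σref (sign-ref T (a p) hs)
  ...       | no t≮k | yes σref = cyclic (connected-lifts-covered σ p (proj₁ (position (a p))) deg≡2 only σp (proj₂ (position (a p))) σref r t≡1+r)
    where
    r : ℕ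
    r = t ∸ 1
    t≡1+r : t ≡ 1 + r
    t≡1+r = sym (m+[n∸m]≡n (≤-trans (s≤s z≤n) 2≤t))
    deg≡2 : ∀ b → degH arc b ≡ 2
    deg≡2 b with degH arc b ≟ 2
    ... | yes e = e
    ... | no ¬e = contradiction (t<k ¬e) t≮k
    only : ∀ p′ → sign σ p′ ≡ false → a p′ ≡ a p
    only p′ σp′ with a p F.≟ a p′
    ... | yes e = sym e
    ... | no ¬e = contradiction (Any.map (λ { refl → σp′ , ¬e }) (positions-full p′)) single
    cyclic : ∃[ L ] length L ≤ m ^ 1 * (D * D) ^ r × CoversLifts σ L → hitsWith σ * Q ≤ m ^ k * N
    cyclic (L , |L| , cov) = lift-bound 1 r 1 C^2q≤m^q t≡1+r
      (trans (+-comm (r + 2 * q) 1) (cong (_+ 2 * q) (sym t≡1+r))) |L| cov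
      (λ T hs _ → hits-once {p = p} σp T hs)

  -- Every tuple has a sign pattern in the list `allFuns signPairs k`, whose length 4^k is the
  -- constant and depends on H only.
  totalCount-bound : totalCount arc E N fam dec * Q ≤ length (allFuns signPairs k) * m ^ k * N
  totalCount-bound = begin
    totalCount arc E N fam dec * Q
      ≡⟨ cong (_* Q) (trans (∑-cong (allFin N) λ i → length-filter≡∑ (dec i) (allTuples n k)) (∑-swap (allFin N) (allTuples n k) (λ i T → ⟦ dec i T ⟧))) ⟩
    ∑ (allTuples n k) hits * Q
      ≤⟨ *-monoˡ-≤ Q (∑-mono (allTuples n k) split) ⟩
    ∑[ T ∈ allTuples n k ] ∑[ σ ∈ σs ] (⟦ hasSign? σ T ⟧ * hits T) * Q
      ≡⟨ cong (_* Q) (∑-swap (allTuples n k) σs (λ T σ → ⟦ hasSign? σ T ⟧ * hits T)) ⟩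
    ∑ σs hitsWith * Q
      ≡⟨ ∑-*ʳ σs hitsWith Q ⟨
    ∑[ σ ∈ σs ] (hitsWith σ * Q)
      ≤⟨ ∑-bound σs bound-by-sign ⟩
    length σs * (m ^ k * N)
      ≡⟨ *-assoc (length σs) (m ^ k) N ⟨
    length σs * m ^ k * N ∎
    where
    open ≤-Reasoning
    σs = allFuns signPairs k
    split : ∀ T → hits T ≤ ∑[ σ ∈ σs ] (⟦ hasSign? σ T ⟧ * hits T)
    split T with allFuns-complete signPairs-full k (signOf T)
    ... | σ , σ∈ , hs = begin
      hits T                                       ≡⟨ *-identityˡ (hits T) ⟨
      1 * hits T                                   ≤⟨ *-monoˡ-≤ (hits T) (1≤∑⟦⟧ (λ σ → hasSign? σ T) σ∈ hs) ⟩
      ∑[ σ ∈ σs ] ⟦ hasSign? σ T ⟧ * hits T        ≡⟨ ∑-*ʳ σs (λ σ → ⟦ hasSign? σ T ⟧) (hits T) ⟨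
      ∑[ σ ∈ σs ] (⟦ hasSign? σ T ⟧ * hits T)      ∎

-- The bound with denominators cleared; Δ² ≤ m^(1-2α) and C ≤ m^(2α) combine to Δ²C ≤ m

theorem3p13 : (t k : ℕ) (arc : Fin k → Fin t × Fin t) →
    SimpleH arc → ConnectedH arc → NoLeavesH arc →
    ∃[ K ] ((n : ℕ) (E : Fin n → Fin n → Bool) → SimpleGraph n E →
    (C : ℕ) → t ≤ C →
    maxDegree n E * maxDegree n E * C ≤ numArcs n E →
    C ^ 3 ≤ numArcs n E →
    (N : ℕ) → NonZero N → (fam : Fin N → Fin n → Fin C) →
    Independent n C N (4 * k) fam →
    (dec : ∀ i → Decidable (Counted arc E (fam i))) →
    totalCount arc E N fam dec * C ^ (2 * k ∸ t) ≤ K * numArcs n E ^ k * N)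
-- Without edges Condition 1 holds vacuously at every vertex, so nothing is counted and the constant
-- 0 works.
theorem3p13 t zero arc simple conn noLeaves = 0 , λ n E graph C t≤C ΔΔC≤m C³≤m N N≢0 fam indep dec →
  ≤-reflexive (cong (_* C ^ (0 ∸ t)) (n≤0⇒n≡0 (≤-trans
    (∑-bound (allFin N) λ i → ≤-trans (≤-reflexive (length-filter≡∑ (dec i) (allTuples n 0)))
      (≤-trans (∑-bound (allTuples n 0) {λ T → ⟦ dec i T ⟧} {0} λ T → ≤-reflexive (⟦⟧-false (dec i T)
        λ (_ , _ , _ , _ , _ , ¬all₁) → ¬all₁ λ _ ()))
      (≤-reflexive (*-zeroʳ (length (allTuples n 0))))))
    (≤-reflexive (*-zeroʳ (length (allFin N)))))))
theorem3p13 t k@(suc _) arc simple conn noLeaves = length (allFuns signPairs k)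
  , λ n E graph C t≤C ΔΔC≤m C³≤m N N≢0 fam indep dec →
    Expectation.totalCount-bound arc simple conn noLeaves (zero , false) E graph
      (maxDegree n E ⊔ 1) (m≤n⊔m (maxDegree n E) 1) (m≤m⊔n (maxDegree n E) 1)
      t≤C (atLeastOne {maxDegree n E} ΔΔC≤m (≤-trans (C≤C³ C) C³≤m)) C³≤m fam indep dec
  where
  C≤C³ : ∀ C → C ≤ C ^ 3
  C≤C³ zero    = z≤n
  C≤C³ (suc C) = m≤m*n (suc C) (suc C ^ 2) {{m^n≢0 (suc C) 2}}
  -- The greedy bound needs D ≥ 1, hence D = max(Δ, 1). For Δ = 0 the claim is C ≤ m, which the
  -- caller gets from C ≤ C³ ≤ m.
  atLeastOne : ∀ {Δ C m} → Δ * Δ * C ≤ m → C ≤ m → (Δ ⊔ 1) * (Δ ⊔ 1) * C ≤ m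
  atLeastOne {zero}  {C} _  C≤m = ≤-trans (≤-reflexive (+-identityʳ C)) C≤m
  atLeastOne {suc Δ} {C} le _   = subst (λ d → suc d * suc d * C ≤ _) (sym (⊔-identityʳ Δ)) le
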